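{- Let $w_1,w_2,w_3$ be any odd positive integers, let $n\ge 0$ be an integer and let $y_1\in\mathbb{Z}_p$. Then \begin{align*} &w_1^{n}\sum_{k=0}^{n}\binom{n}{k}T_{n-k,q^{w_1w_2}}(w_3-1)\,w_2^{n-k}w_3^{k}\sum_{i=0}^{w_1-1}(-1)^{i}q^{w_2w_3i}E_{k,q^{w_1w_3}}\Big(w_2y_1+\frac{w_2}{w_1}i\Big)\\ =&\,w_1^{n}\sum_{k=0}^{n}\binom{n}{k}T_{n-k,q^{w_1w_3}}(w_2-1)\,w_3^{n-k}w_2^{k}\sum_{i=0}^{w_1-1}(-1)^{i}q^{w_2w_3i}E_{k,q^{w_1w_2}}\Big(w_3y_1+\frac{w_3}{w_1}i\Big)\\ =&\,w_2^{n}\sum_{k=0}^{n}\binom{n}{k}T_{n-k,q^{w_1w_2}}(w_3-1)\,w_1^{n-k}w_3^{k}\sum_{i=0}^{w_2-1}(-1)^{i}q^{w_1w_3i}E_{k,q^{w_2w_3}}\Big(w_1y_1+\frac{w_1}{w_2}i\Big)\\ =&\,w_2^{n}\sum_{k=0}^{n}\binom{n}{k}T_{n-k,q^{w_2w_3}}(w_1-1)\,w_3^{n-k}w_1^{k}\sum_{i=0}^{w_2-1}(-1)^{i}q^{w_1w_3i}E_{k,q^{w_1w_2}}\Big(w_3y_1+\frac{w_3}{w_2}i\Big)\\ =&\,w_3^{n}\sum_{k=0}^{n}\binom{n}{k}T_{n-k,q^{w_1w_3}}(w_2-1)\,w_1^{n-k}w_2^{k}\sum_{i=0}^{w_3-1}(-1)^{i}q^{w_1w_2i}E_{k,q^{w_2w_3}}\Big(w_1y_1+\frac{w_1}{w_3}i\Big)\\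 =&\,w_3^{n}\sum_{k=0}^{n}\binom{n}{k}T_{n-k,q^{w_2w_3}}(w_1-1)\,w_2^{n-k}w_1^{k}\sum_{i=0}^{w_3-1}(-1)^{i}q^{w_1w_2i}E_{k,q^{w_1w_3}}\Big(w_2y_1+\frac{w_2}{w_3}i\Big). \end{align*}
   Context: Let $p$ be a fixed odd prime, $\mathbb{C}_p$ the completion of an algebraic closure of $\mathbb{Q}_p$ with absolute value normalized by $|p|_p=1/p$, and let $q\in\mathbb{C}_p$ be fixed with $|q-1|_p<p^{ -1/(p-1)}$. For $r\in\mathbb{C}_p$ with $|r-1|_p<p^{ -1/(p-1)}$ (in particular for $r=q^w$, $w$ a positive integer), the $r$-Euler polynomials $E_{n,r}(x)$ ($n\ge 0$) are the polynomials in $x$ defined by the generating function $$\frac{2}{re^{t}+1}e^{xt}=\sum_{n=0}^{\infty}E_{n,r}(x)\frac{t^n}{n!}.$$ For integers $k,N\ge 0$, the $r$-analogue of the alternating power sum is $T_{k,r}(N)=\sum_{i=0}^{N}(-1)^i i^k r^i$, with the convention $0^0=1$. -}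

module Defs where

open import Level using (0ℓ)
open import Algebra.Bundles using (CommutativeRing)
open import Algebra.Apartness.Bundles using (HeytingField; HeytingCommutativeRing)
open import Algebra.Morphism.Structures using (IsRingHomomorphism)
open import Algebra.Morphism.Construct.Composition using (isRingHomomorphism)
import Algebra.Definitions as AlgebraDefinitions
import Algebra.Apartness.Properties.HeytingCommutativeRing as HeytingProperties
import Algebra.Properties.Ring as RingProperties
import Algebra.Properties.Semiring.Exp as SemiringExp
import Algebra.Properties.Semiring.Sum as SemiringSum
open import Data.Empty using (⊥-elim)
open import Data.Fin.Base using (zero; suc; toℕ)
open import Data.Integer.Base as ℤ using (+_)
import Data.Integer.Properties as ℤ-Prop
open import Data.Nat.Base as ℕ using (ℕ; zero; suc; _∸_; _!; NonZero)
import Data.Nat.Properties as ℕ-Prop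
open import Data.Nat.Primality using (Prime)
open import Data.Product.Base using (Σ; ∃; _×_; _,_; proj₁; proj₂)
open import Data.Rational.Base as ℚ using (ℚ; 0ℚ; 1ℚ)
import Data.Rational.Properties as ℚ-Prop
import Data.Rational.Unnormalised.Base as ℚᵘ
import Data.Rational.Unnormalised.Properties as ℚᵘ-Prop
open import Data.Sum.Base using (_⊎_; inj₁; inj₂)
open import Data.Vec.Base using (Vec; []; _∷_; head; lookup)
open import Data.Vec.Functional using (Vector)
open import Function.Base using (_∘_)
open import Relation.Binary.PropositionalEquality as ≡ using (_≡_)

Odd : ℕ → Set
Odd n = ∃ λ k → n ≡ 1 ℕ.+ 2 ℕ.* k

-- The absolute value is given by its exponent: |x| = p^(- v x) for x ≠ 0,
-- with v x ∈ ℚ (the value group of ℂₚ is p^ℚ).  The field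
-- v-+ is |x + y| ≤ max (|x| , |y|), stated positively so that it remains
-- meaningful when equality with 0 is not decidable.
record ValuedField : Set₁ where
  field
    heytingField : HeytingField 0ℓ 0ℓ 0ℓ

  open HeytingField heytingField public

  commutativeRing : CommutativeRing 0ℓ 0ℓ
  commutativeRing = HeytingCommutativeRing.commutativeRing heytingCommutativeRing

  open CommutativeRing commutativeRing public using (rawRing; ring; semiring)
  open SemiringExp semiring public using (_^_)
  open SemiringSum semiring public using (sum; sum-syntax; sum⁺-syntax)

  field
    v      : ∀ {x} → x # 0# → ℚ
    v-cong : ∀ {x y} (x#0 : x # 0#) (y#0 : y # 0#) → x ≈ y → v x#0 ≡ v y#0
    v-*    : ∀ {x y} (x#0 : x # 0#) (y#0 : y # 0#) (xy#0 : x * y # 0#) →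
             v xy#0 ≡ v x#0 ℚ.+ v y#0
    v-+    : ∀ {x y} (x+y#0 : x + y # 0#) →
             (Σ (x # 0#) λ x#0 → v x#0 ℚ.≤ v x+y#0) ⊎
             (Σ (y # 0#) λ y#0 → v y#0 ℚ.≤ v x+y#0)

  infix 4 ∣_∣<p^-_ ∣_∣≤p^-_

  ∣_∣<p^-_ : Carrier → ℚ → Set
  ∣ x ∣<p^- γ = (x#0 : x # 0#) → γ ℚ.< v x#0

  ∣_∣≤p^-_ : Carrier → ℚ → Set
  ∣ x ∣≤p^- γ = (x#0 : x # 0#) → γ ℚ.≤ v x#0

  Cauchy : (ℕ → Carrier) → Set
  Cauchy s = ∀ γ → ∃ λ N → ∀ m n → N ℕ.≤ m → N ℕ.≤ n → ∣ s m - s n ∣<p^- γ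

  _ConvergesTo_ : (ℕ → Carrier) → Carrier → Set
  s ConvergesTo l = ∀ γ → ∃ λ N → ∀ n → N ℕ.≤ n → ∣ s n - l ∣<p^- γ

  Complete : Set
  Complete = ∀ s → Cauchy s → ∃ λ l → s ConvergesTo l

  -- f has dense image.
  Dense : {A : Set} → (A → Carrier) → Set
  Dense f = ∀ x γ → ∃ λ a → ∣ x - f a ∣<p^- γ

  -- zⁿ + aₙ₋₁ zⁿ⁻¹ + ⋯ + a₀
  evalMonic : ∀ {n} → Vector Carrier n → Carrier → Carrier
  evalMonic {n} a z = z ^ n + ∑[ i < n ] (a i * z ^ toℕ i)

  AlgebraicallyClosed : Set
  AlgebraicallyClosed = ∀ {n} (a : Vector Carrier (suc n)) → ∃ λ z → evalMonic a z ≈ 0#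

ℚ-ring : CommutativeRing 0ℓ 0ℓ
ℚ-ring = ℚ-Prop.+-*-commutativeRing

IsHom : (R S : CommutativeRing 0ℓ 0ℓ) →
        (CommutativeRing.Carrier R → CommutativeRing.Carrier S) → Set
IsHom R S = IsRingHomomorphism (CommutativeRing.rawRing R) (CommutativeRing.rawRing S)

record ValuedExtension (K L : ValuedField) : Set where
  private
    module K = ValuedField K
    module L = ValuedField L
  field
    ⟦_⟧   : K.Carrier → L.Carrier
    isHom : IsHom K.commutativeRing L.commutativeRing ⟦_⟧
    v-⟦⟧  : ∀ {x} (x#0 : x K.# K.0#) (⟦x⟧#0 : ⟦ x ⟧ L.# L.0#) → L.v ⟦x⟧#0 ≡ K.v x#0

  Algebraic : Set
  Algebraic = ∀ z → ∃ λ n → Σ (Vector K.Carrier n) λ a → L.evalMonic (⟦_⟧ ∘ a) z L.≈ L.0#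

-- The tower ℚ → ℚₚ → ℚₚᵃ → ℂₚ: p-adic completion, algebraic closure,
-- completion.  Each step is unique up to isomorphism.  The restriction of v
-- to ℚ is the p-adic valuation: the normalisation v p = 1 (|p| = 1/p) and
-- the ultrametric inequality leave no other possibility.
record PadicTower (p : ℕ) : Set₁ where
  field
    ℚₚ ℚₚᵃ ℂₚ : ValuedField

  module ℚₚ = ValuedField ℚₚ
  module ℚₚᵃ = ValuedField ℚₚᵃ
  module ℂₚ = ValuedField ℂₚ

  field
    ℚ→ℚₚ          : ℚ → ℚₚ.Carrier
    ℚ→ℚₚ-isHom    : IsHom ℚ-ring ℚₚ.commutativeRing ℚ→ℚₚ
    v-p           : Σ (ℚ→ℚₚ (+ p ℚ./ 1) ℚₚ.# ℚₚ.0#) λ p#0 → ℚₚ.v p#0 ≡ 1ℚ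
    ℚ-dense       : ℚₚ.Dense ℚ→ℚₚ
    ℚₚ-complete   : ℚₚ.Complete

    ℚₚ→ℚₚᵃ         : ValuedExtension ℚₚ ℚₚᵃ
    ℚₚᵃ-algebraic  : ValuedExtension.Algebraic ℚₚ→ℚₚᵃ
    ℚₚᵃ-algClosed  : ℚₚᵃ.AlgebraicallyClosed

    ℚₚᵃ→ℂₚ         : ValuedExtension ℚₚᵃ ℂₚ
    ℚₚᵃ-dense      : ℂₚ.Dense (ValuedExtension.⟦_⟧ ℚₚᵃ→ℂₚ)
    ℂₚ-complete   : ℂₚ.Complete

  IsPadicInteger : ℚₚ.Carrier → Set
  IsPadicInteger y = ℚₚ.∣ y ∣≤p^- 0ℚ

  ℚₚ→ℂₚ : ℚₚ.Carrier → ℂₚ.Carrier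
  ℚₚ→ℂₚ = ValuedExtension.⟦_⟧ ℚₚᵃ→ℂₚ ∘ ValuedExtension.⟦_⟧ ℚₚ→ℚₚᵃ

  ℚ→ℂₚ : ℚ → ℂₚ.Carrier
  ℚ→ℂₚ = ℚₚ→ℂₚ ∘ ℚ→ℚₚ

module PowerSeries (R : CommutativeRing 0ℓ 0ℓ) where
  open CommutativeRing R
  open AlgebraDefinitions _≈_ using (Invertible)
  open SemiringSum semiring using (sum-cong-≋; sum⁺-syntax)
  open RingProperties ring using (-‿distribʳ-*)

  Series : Set
  Series = ℕ → Carrier

  infix  4 _≈ₛ_
  infixl 6 _+ₛ_
  infixl 7 _*ₛ_ _·ₛ_

  _≈ₛ_ : Series → Series → Set
  f ≈ₛ g = ∀ n → f n ≈ g n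

  1ₛ : Series
  1ₛ zero    = 1#
  1ₛ (suc _) = 0#

  _+ₛ_ : Series → Series → Series
  (f +ₛ g) n = f n + g n

  _·ₛ_ : Carrier → Series → Series
  (c ·ₛ f) n = c * f n

  _*ₛ_ : Series → Series → Series
  (f *ₛ g) n = ∑[ i ≤ n ] (f (toℕ i) * g (n ∸ toℕ i))

  module _ (f : Series) (u : Invertible 1# _*_ (f 0)) where
    private
      f₀⁻¹ : Carrier
      f₀⁻¹ = proj₁ u

    -- The coefficients gₙ, …, g₀ of 1/f, obtained by solving
    -- f₀ gₙ₊₁ + f₁ gₙ + ⋯ + fₙ₊₁ g₀ = 0.
    inverses : (n : ℕ) → Vec Carrier (suc n)
    inverses zero    = f₀⁻¹ ∷ []
    inverses (suc n) =
      - (f₀⁻¹ * ∑[ i ≤ n ] (f (suc (toℕ i)) * lookup (inverses n) i)) ∷ inverses n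

    inverse : Series
    inverse n = head (inverses n)

    lookup-inverses : ∀ n i → lookup (inverses n) i ≡ inverse (n ∸ toℕ i)
    lookup-inverses zero    zero    = ≡.refl
    lookup-inverses (suc n) zero    = ≡.refl
    lookup-inverses (suc n) (suc i) = lookup-inverses n i

    *ₛ-inverseʳ : f *ₛ inverse ≈ₛ 1ₛ
    *ₛ-inverseʳ zero    = trans (+-identityʳ _) (proj₂ (proj₂ u))
    *ₛ-inverseʳ (suc n) = begin
      f 0 * - (f₀⁻¹ * s) + s′    ≈⟨ +-cong (-‿distribʳ-* _ _) s≈s′ ⟨
      - (f 0 * (f₀⁻¹ * s)) + s   ≈⟨ +-congʳ (-‿cong (*-assoc _ _ _)) ⟨
      - (f 0 * f₀⁻¹ * s) + s     ≈⟨ +-congʳ (-‿cong (*-congʳ (proj₂ (proj₂ u)))) ⟩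
      - (1# * s) + s             ≈⟨ +-congʳ (-‿cong (*-identityˡ s)) ⟩
      - s + s                    ≈⟨ -‿inverseˡ s ⟩
      0#                         ∎
      where
      open import Relation.Binary.Reasoning.Setoid setoid
      s s′ : Carrier
      s  = ∑[ i ≤ n ] (f (suc (toℕ i)) * lookup (inverses n) i)
      s′ = ∑[ i ≤ n ] (f (suc (toℕ i)) * inverse (n ∸ toℕ i))
      s≈s′ : s ≈ s′
      s≈s′ = sum-cong-≋ {suc n} λ i → *-congˡ {f (suc (toℕ i))} (reflexive (lookup-inverses n i))

module ValuedFieldProperties (K : ValuedField) where
  open ValuedField K
  open HeytingProperties heytingCommutativeRing public using (1#0; #-congʳ; x-0≈x; x#0y#0→xy#0)
  open RingProperties ring using (-1*x≈-x; -‿involutive; x[y-z]≈xy-xz)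
  open AlgebraDefinitions _≈_ using (Invertible)
  open import Relation.Binary.Reasoning.Setoid setoid

  #0⇒invertible : ∀ {x} → x # 0# → Invertible 1# _*_ x
  #0⇒invertible {x} x#0 with #⇒invertible x#0
  ... | y , yx , xy = y , trans (*-congˡ (sym (x-0≈x x))) yx , trans (*-congʳ (sym (x-0≈x x))) xy

  unit⇒#0 : ∀ {x} y → x * y ≈ 1# → x # 0#
  unit⇒#0 {x} y xy≈1 = invertible⇒# (y ,
    trans (*-congˡ (x-0≈x x)) (trans (*-comm y x) xy≈1) , trans (*-congʳ (x-0≈x x)) xy≈1)

  *#0ˡ : ∀ {x y} → x * y # 0# → x # 0#
  *#0ˡ {x} {y} xy#0 with #0⇒invertible xy#0
  ... | z , _ , xyz≈1 = unit⇒#0 (y * z) (trans (sym (*-assoc x y z)) xyz≈1)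

  *#0ʳ : ∀ {x y} → x * y # 0# → y # 0#
  *#0ʳ {x} {y} xy#0 = *#0ˡ (#-congʳ (*-comm x y) xy#0)

  v-1 : (h : 1# # 0#) → v h ≡ 0ℚ
  v-1 h = identityʳ-unique _ _ (≡.sym
    (≡.trans (v-cong h (x#0y#0→xy#0 h h) (sym (*-identityˡ 1#))) (v-* h h (x#0y#0→xy#0 h h))))
    where open import Algebra.Properties.Group (CommutativeRing.+-group ℚ-ring)

  ≤p^-0-cong : ∀ {x y} → x ≈ y → ∣ x ∣≤p^- 0ℚ → ∣ y ∣≤p^- 0ℚ
  ≤p^-0-cong x≈y ∣x∣≤1 y#0 =
    ≡.subst (0ℚ ℚ.≤_) (v-cong _ y#0 x≈y) (∣x∣≤1 (#-congʳ (sym x≈y) y#0))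

  ≤p^-0-0 : ∀ {x} → x ≈ 0# → ∣ x ∣≤p^- 0ℚ
  ≤p^-0-0 x≈0 x#0 = ⊥-elim (#-irrefl x≈0 x#0)

  ≤p^-0-1 : ∣ 1# ∣≤p^- 0ℚ
  ≤p^-0-1 h = ℚ-Prop.≤-reflexive (≡.sym (v-1 h))

  ≤p^-0-+ : ∀ {x y} → ∣ x ∣≤p^- 0ℚ → ∣ y ∣≤p^- 0ℚ → ∣ x + y ∣≤p^- 0ℚ
  ≤p^-0-+ ∣x∣≤1 ∣y∣≤1 h with v-+ h
  ... | inj₁ (x#0 , le) = ℚ-Prop.≤-trans (∣x∣≤1 x#0) le
  ... | inj₂ (y#0 , le) = ℚ-Prop.≤-trans (∣y∣≤1 y#0) le

  ≤p^-0-* : ∀ {x y} → ∣ x ∣≤p^- 0ℚ → ∣ y ∣≤p^- 0ℚ → ∣ x * y ∣≤p^- 0ℚ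
  ≤p^-0-* ∣x∣≤1 ∣y∣≤1 h = ≡.subst (0ℚ ℚ.≤_) (≡.sym (v-* (*#0ˡ h) (*#0ʳ h) h))
    (ℚ-Prop.+-mono-≤ (∣x∣≤1 (*#0ˡ h)) (∣y∣≤1 (*#0ʳ h)))

  -1*-1≈1 : - 1# * - 1# ≈ 1#
  -1*-1≈1 = trans (-1*x≈-x (- 1#)) (-‿involutive 1#)

  ≤p^-0--1 : ∣ - 1# ∣≤p^- 0ℚ
  ≤p^-0--1 h = ℚ-Prop.≮⇒≥ λ v<0 → ℚ-Prop.<-irrefl v+v≡0 (ℚ-Prop.+-mono-< {v h} {0ℚ} {v h} {0ℚ} v<0 v<0)
    where
    v+v≡0 : v h ℚ.+ v h ≡ 0ℚ
    v+v≡0 = ≡.trans (≡.sym (v-* h h (x#0y#0→xy#0 h h)))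
                    (≡.trans (v-cong (x#0y#0→xy#0 h h) 1#0 -1*-1≈1) (v-1 1#0))

  <p^--cong : ∀ {x y γ} → x ≈ y → ∣ x ∣<p^- γ → ∣ y ∣<p^- γ
  <p^--cong {γ = γ} x≈y ∣x∣< y#0 =
    ≡.subst (γ ℚ.<_) (v-cong _ y#0 x≈y) (∣x∣< (#-congʳ (sym x≈y) y#0))

  <p^--* : ∀ {x y γ} → ∣ x ∣≤p^- 0ℚ → ∣ y ∣<p^- γ → ∣ x * y ∣<p^- γ
  <p^--* {γ = γ} ∣x∣≤1 ∣y∣< h =
    ≡.subst₂ ℚ._<_ (ℚ-Prop.+-identityˡ γ) (≡.sym (v-* (*#0ˡ h) (*#0ʳ h) h))
      (ℚ-Prop.+-mono-≤-< (∣x∣≤1 (*#0ˡ h)) (∣y∣< (*#0ʳ h)))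

  <p^--+ : ∀ {x y γ} → ∣ x ∣<p^- γ → ∣ y ∣<p^- γ → ∣ x + y ∣<p^- γ
  <p^--+ ∣x∣< ∣y∣< h with v-+ h
  ... | inj₁ (x#0 , le) = ℚ-Prop.<-≤-trans (∣x∣< x#0) le
  ... | inj₂ (y#0 , le) = ℚ-Prop.<-≤-trans (∣y∣< y#0) le

  module _ {γ : ℚ} (0<γ : 0ℚ ℚ.< γ) where

    near1⇒≤p^-0 : ∀ {r} → ∣ r - 1# ∣<p^- γ → ∣ r ∣≤p^- 0ℚ
    near1⇒≤p^-0 {r} r∈ = ≤p^-0-cong r-1+1≈r
      (≤p^-0-+ (λ h → ℚ-Prop.<⇒≤ (ℚ-Prop.<-trans 0<γ (r∈ h))) ≤p^-0-1)
      where
      r-1+1≈r : r - 1# + 1# ≈ r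
      r-1+1≈r = trans (+-assoc r (- 1#) 1#) (trans (+-congˡ (-‿inverseˡ 1#)) (+-identityʳ r))

    near1-1 : ∣ 1# - 1# ∣<p^- γ
    near1-1 h = ⊥-elim (#-irrefl (-‿inverseʳ 1#) h)

    near1-* : ∀ {r s} → ∣ r - 1# ∣<p^- γ → ∣ s - 1# ∣<p^- γ → ∣ r * s - 1# ∣<p^- γ
    near1-* {r} {s} r∈ s∈ = <p^--cong lemma (<p^--+ (<p^--* (near1⇒≤p^-0 r∈) s∈) r∈)
      where
      lemma : r * (s - 1#) + (r - 1#) ≈ r * s - 1#
      lemma = begin
        r * (s - 1#) + (r - 1#)        ≈⟨ +-congʳ (x[y-z]≈xy-xz r s 1#) ⟩
        r * s - r * 1# + (r - 1#)      ≈⟨ +-congʳ (+-congˡ (-‿cong (*-identityʳ r))) ⟩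
        r * s - r + (r - 1#)           ≈⟨ +-assoc (r * s) (- r) (r - 1#) ⟩
        r * s + (- r + (r - 1#))       ≈⟨ +-congˡ (+-assoc (- r) r (- 1#)) ⟨
        r * s + ((- r + r) - 1#)       ≈⟨ +-congˡ (+-congʳ (-‿inverseˡ r)) ⟩
        r * s + (0# - 1#)              ≈⟨ +-congˡ (+-identityˡ (- 1#)) ⟩
        r * s - 1#                     ∎

    near1-^ : ∀ {r} → ∣ r - 1# ∣<p^- γ → ∀ m → ∣ r ^ m - 1# ∣<p^- γ
    near1-^ r∈ zero    = near1-1
    near1-^ r∈ (suc m) = near1-* r∈ (near1-^ r∈ m)

    near1⇒r+1#0 : (2#0 : 1# + 1# # 0#) → v 2#0 ℚ.≤ 0ℚ → ∀ {r} → ∣ r - 1# ∣<p^- γ → r + 1# # 0#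
    near1⇒r+1#0 2#0 v2≤0 {r} r∈ = conclude (v-+ (#-congʳ 2≈ 2#0))
      where
      2≈ : 1# + 1# ≈ (r + 1#) + - 1# * (r - 1#)
      2≈ = sym (begin
        (r + 1#) + - 1# * (r - 1#)        ≈⟨ +-congˡ (x[y-z]≈xy-xz (- 1#) r 1#) ⟩
        (r + 1#) + (- 1# * r - - 1# * 1#) ≈⟨ +-congˡ (+-cong (-1*x≈-x r) (-‿cong (*-identityʳ (- 1#)))) ⟩
        (r + 1#) + (- r - - 1#)           ≈⟨ +-cong (+-comm r 1#) (+-congˡ (-‿involutive 1#)) ⟩
        (1# + r) + (- r + 1#)             ≈⟨ +-assoc 1# r (- r + 1#) ⟩
        1# + (r + (- r + 1#))             ≈⟨ +-congˡ (+-assoc r (- r) 1#) ⟨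
        1# + (r - r + 1#)                 ≈⟨ +-congˡ (+-congʳ (-‿inverseʳ r)) ⟩
        1# + (0# + 1#)                    ≈⟨ +-congˡ (+-identityˡ 1#) ⟩
        1# + 1#                           ∎)

      conclude : (Σ (r + 1# # 0#) λ h → v h ℚ.≤ v (#-congʳ 2≈ 2#0)) ⊎
                 (Σ (- 1# * (r - 1#) # 0#) λ h → v h ℚ.≤ v (#-congʳ 2≈ 2#0)) → r + 1# # 0#
      conclude (inj₁ (r+1#0 , _)) = r+1#0
      conclude (inj₂ (h , le))    = ⊥-elim (ℚ-Prop.<-irrefl ≡.refl
        (ℚ-Prop.<-≤-trans (ℚ-Prop.<-trans 0<γ (<p^--* ≤p^-0--1 r∈ h))
          (ℚ-Prop.≤-trans le (≡.subst (ℚ._≤ 0ℚ) (v-cong 2#0 _ 2≈) v2≤0))))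

module _ {K L : ValuedField} (ext : ValuedExtension K L) where
  private
    module K = ValuedField K
    module L = ValuedField L
  open ValuedExtension ext
  open IsRingHomomorphism isHom using (*-homo; 1#-homo; ⟦⟧-cong)

  ⟦⟧#0 : ∀ {x} → x K.# K.0# → ⟦ x ⟧ L.# L.0#
  ⟦⟧#0 {x} x#0 = invert (ValuedFieldProperties.#0⇒invertible K x#0)
    where
    invert : (∃ λ y → (y K.* x K.≈ K.1#) × (x K.* y K.≈ K.1#)) → ⟦ x ⟧ L.# L.0#
    invert (y , _ , xy≈1) = ValuedFieldProperties.unit⇒#0 L ⟦ y ⟧
      (L.trans (L.sym (*-homo x y)) (L.trans (⟦⟧-cong xy≈1) 1#-homo))

module _ (K : ValuedField) (ι : ℚ → ValuedField.Carrier K)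
         (ι-isHom : IsHom ℚ-ring (ValuedField.commutativeRing K) ι) where
  open ValuedField K
  open ValuedFieldProperties K
  open IsRingHomomorphism ι-isHom
  open RingProperties ring using (-1*x≈-x)
  open import Relation.Binary.Reasoning.Setoid setoid

  /1-+ : ∀ m n → + (m ℕ.+ n) ℚ./ 1 ≡ (+ m ℚ./ 1) ℚ.+ (+ n ℚ./ 1)
  /1-+ m n = ℚ-Prop.toℚᵘ-injective (ℚᵘ-Prop.≃-trans (to (m ℕ.+ n))
    (ℚᵘ-Prop.≃-sym (ℚᵘ-Prop.≃-trans (ℚ-Prop.toℚᵘ-homo-+ (+ m ℚ./ 1) (+ n ℚ./ 1))
      (ℚᵘ-Prop.≃-trans (ℚᵘ-Prop.+-cong (to m) (to n)) sum≃))))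
    where
    to : ∀ k → ℚ.toℚᵘ (+ k ℚ./ 1) ℚᵘ.≃ ℚᵘ.mkℚᵘ (+ k) 0
    to k = ℚ-Prop.toℚᵘ-fromℚᵘ (ℚᵘ.mkℚᵘ (+ k) 0)
    sum≃ : ℚᵘ.mkℚᵘ (+ m) 0 ℚᵘ.+ ℚᵘ.mkℚᵘ (+ n) 0 ℚᵘ.≃ ℚᵘ.mkℚᵘ (+ (m ℕ.+ n)) 0
    sum≃ = ℚᵘ.*≡* (≡.cong (ℤ._* + 1)
      (≡.cong₂ ℤ._+_ (ℤ-Prop.*-identityʳ (+ m)) (ℤ-Prop.*-identityʳ (+ n))))

  ι-+ : ∀ m n → ι (+ (m ℕ.+ n) ℚ./ 1) ≈ ι (+ m ℚ./ 1) + ι (+ n ℚ./ 1)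
  ι-+ m n = trans (reflexive (≡.cong ι (/1-+ m n))) (+-homo _ _)

  ι-≤p^-0 : ∀ n → ∣ ι (+ n ℚ./ 1) ∣≤p^- 0ℚ
  ι-≤p^-0 zero    = ≤p^-0-0 0#-homo
  ι-≤p^-0 (suc n) = ≤p^-0-cong (sym (ι-+ 1 n))
    (≤p^-0-+ (≤p^-0-cong (sym 1#-homo) ≤p^-0-1) (ι-≤p^-0 n))

  v-2≤0 : ∀ {p} → Odd p → (p#0 : ι (+ p ℚ./ 1) # 0#) → v p#0 ≡ 1ℚ →
          Σ (1# + 1# # 0#) λ 2#0 → v 2#0 ℚ.≤ 0ℚ
  v-2≤0 (k , ≡.refl) p#0 vp≡1 = conclude (v-+ (#-congʳ 1≈ 1#0))
    where
    P κ : Carrier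
    P = ι (+ (1 ℕ.+ 2 ℕ.* k) ℚ./ 1)
    κ = ι (+ k ℚ./ 1)

    P≈ : P ≈ 1# + (1# + 1#) * κ
    P≈ = begin
      P                             ≈⟨ ι-+ 1 (2 ℕ.* k) ⟩
      ι 1ℚ + ι (+ (2 ℕ.* k) ℚ./ 1)  ≈⟨ +-cong 1#-homo (ι-+ k (k ℕ.+ 0)) ⟩
      1# + (κ + ι (+ (k ℕ.+ 0) ℚ./ 1)) ≡⟨ ≡.cong (λ j → 1# + (κ + ι (+ j ℚ./ 1))) (ℕ-Prop.+-identityʳ k) ⟩
      1# + (κ + κ)                  ≈⟨ +-congˡ (+-cong (*-identityˡ κ) (*-identityˡ κ)) ⟨
      1# + (1# * κ + 1# * κ)        ≈⟨ +-congˡ (distribʳ κ 1# 1#) ⟨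
      1# + (1# + 1#) * κ            ∎

    y : Carrier
    y = (1# + 1#) * (- 1# * κ)

    1≈ : 1# ≈ P + y
    1≈ = sym (begin
      P + y                                           ≈⟨ +-cong P≈ (*-congˡ (-1*x≈-x κ)) ⟩
      1# + (1# + 1#) * κ + (1# + 1#) * - κ            ≈⟨ +-assoc _ _ _ ⟩
      1# + ((1# + 1#) * κ + (1# + 1#) * - κ)          ≈⟨ +-congˡ (distribˡ _ _ _) ⟨
      1# + (1# + 1#) * (κ - κ)                        ≈⟨ +-congˡ (*-congˡ (-‿inverseʳ κ)) ⟩
      1# + (1# + 1#) * 0#                             ≈⟨ +-congˡ (zeroʳ _) ⟩
      1# + 0#                                         ≈⟨ +-identityʳ 1# ⟩
      1#                                              ∎)

    v1≡0 : v (#-congʳ 1≈ 1#0) ≡ 0ℚ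
    v1≡0 = ≡.trans (v-cong _ 1#0 (sym 1≈)) (v-1 1#0)

    conclude : (Σ (P # 0#) λ h → v h ℚ.≤ v (#-congʳ 1≈ 1#0)) ⊎
               (Σ (y # 0#) λ h → v h ℚ.≤ v (#-congʳ 1≈ 1#0)) →
               Σ (1# + 1# # 0#) λ 2#0 → v 2#0 ℚ.≤ 0ℚ
    conclude (inj₁ (h , le)) = ⊥-elim (ℚ-Prop.<-irrefl ≡.refl
      (ℚ-Prop.<-≤-trans (ℚ-Prop.positive⁻¹ 1ℚ)
        (≡.subst₂ ℚ._≤_ (≡.trans (v-cong h p#0 refl) vp≡1) v1≡0 le)))
    conclude (inj₂ (h , le)) = *#0ˡ h , ℚ-Prop.≤-trans
      (≡.subst₂ ℚ._≤_ (ℚ-Prop.+-identityʳ _) (≡.sym (v-* (*#0ˡ h) (*#0ʳ h) h))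
        (ℚ-Prop.+-monoʳ-≤ (v (*#0ˡ h)) (≤p^-0-* ≤p^-0--1 (ι-≤p^-0 k) (*#0ʳ h))))
      (≡.subst (v h ℚ.≤_) v1≡0 le)

module Euler {p : ℕ} (p-prime : Prime p) (p-odd : Odd p) (tower : PadicTower p) where
  open PadicTower tower public
  open ℂₚ public
  open ValuedFieldProperties ℂₚ using (#0⇒invertible; #-congʳ; near1-^; near1⇒r+1#0)
  open PowerSeries commutativeRing

  private
    module E₁ = ValuedExtension ℚₚ→ℚₚᵃ
    module E₂ = ValuedExtension ℚₚᵃ→ℂₚ

  ℚ→ℂₚ-isHom : IsHom ℚ-ring commutativeRing ℚ→ℂₚ
  ℚ→ℂₚ-isHom = isRingHomomorphism (ℂₚ.trans)
    (isRingHomomorphism ℚₚᵃ.trans ℚ→ℚₚ-isHom E₁.isHom) E₂.isHom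

  private
    2#0 : Σ (1# + 1# # 0#) λ h → v h ℚ.≤ 0ℚ
    2#0 = v-2≤0 ℂₚ ℚ→ℂₚ ℚ→ℂₚ-isHom p-odd h₂
      (≡.trans (E₂.v-⟦⟧ h₁ h₂) (≡.trans (E₁.v-⟦⟧ (proj₁ v-p) h₁) (proj₂ v-p)))
      where
      h₁ = ⟦⟧#0 ℚₚ→ℚₚᵃ (proj₁ v-p)
      h₂ = ⟦⟧#0 ℚₚᵃ→ℂₚ h₁

  ⌜_⌝ : ℕ → Carrier
  ⌜ n ⌝ = ℚ→ℂₚ (+ n ℚ./ 1)

  instance
    p-1≢0 : NonZero (p ∸ 1)
    p-1≢0 = helper p-prime
      where
      helper : ∀ {n} → Prime n → NonZero (n ∸ 1)
      helper {suc (suc n)} _ = _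

  -- |r - 1| < p^(-1/(p-1))
  InDisc : Carrier → Set
  InDisc r = ∣ r - 1# ∣<p^- (+ 1 ℚ./ (p ∸ 1))

  private
    0<1/[p-1] : 0ℚ ℚ.< + 1 ℚ./ (p ∸ 1)
    0<1/[p-1] = ℚ-Prop.positive⁻¹ _ {{ℚ-Prop.normalize-pos 1 (p ∸ 1)}}

  InDisc-^ : ∀ {r} → InDisc r → ∀ m → InDisc (r ^ m)
  InDisc-^ = near1-^ 0<1/[p-1]

  -- e^(x t)
  expₛ : Carrier → Series
  expₛ x n = x ^ n * ℚ→ℂₚ ((+ 1 ℚ./ (n !)) {{ℕ-Prop._!≢0 n}})

  -- r e^t + 1
  denominator : Carrier → Series
  denominator r = r ·ₛ expₛ 1# +ₛ 1ₛ

  denominator₀#0 : ∀ {r} → InDisc r → denominator r 0 # 0#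
  denominator₀#0 {r} r∈ = #-congʳ
    (+-congʳ (sym (trans (*-congˡ (trans (*-identityˡ _) (IsRingHomomorphism.1#-homo ℚ→ℂₚ-isHom))) (*-identityʳ r))))
    (near1⇒r+1#0 0<1/[p-1] (proj₁ 2#0) (proj₂ 2#0) r∈)

  -- 2 / (r e^t + 1) · e^(x t)
  eulerSeries : (r : Carrier) → InDisc r → Carrier → Series
  eulerSeries r r∈ x =
    (⌜ 2 ⌝ ·ₛ inverse (denominator r) (#0⇒invertible (denominator₀#0 r∈))) *ₛ expₛ x

  -- The value at x of the r-Euler polynomial E_{n,r}.
  E : ℕ → (r : Carrier) → InDisc r → Carrier → Carrier
  E n r r∈ x = ⌜ n ! ⌝ * eulerSeries r r∈ x n

  T : ℕ → Carrier → ℕ → Carrier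
  T k r N = ∑[ i ≤ N ] ((- 1#) ^ toℕ i * ⌜ toℕ i ⌝ ^ k * r ^ toℕ i)

{-# OPTIONS --safe #-}
-- Write u_m = q^m e^(mt).  For m = ab the power sums T_{l,q^m}(c - 1) m^l are the
-- coefficients (times l!) of ∑_{i<c} (-u_m)^i, which for odd c is the geometric sum
-- (1 + u_{mc}) / (1 + u_m).  The same identity sums over i the generating functions of
-- the Euler polynomials.  Each of the six sums is therefore n! times the coefficient
-- of t^n in
--   2 e^(w₁w₂w₃yt) (1 + u_{w₁w₂w₃})² / ((1 + u_{w₁w₂}) (1 + u_{w₁w₃}) (1 + u_{w₂w₃})),
-- which is symmetric in w₁, w₂, w₃.
module Submission where

open import Defs
open import Level using (0ℓ)
open import Algebra.Bundles using (CommutativeRing)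
open import Algebra.Morphism.Structures using (IsRingHomomorphism)
import Algebra.Properties.CommutativeSemiring.Binomial as BinomialTheorem
import Algebra.Properties.CommutativeSemiring.Exp as Exp
import Algebra.Properties.Ring as RingProperties
import Algebra.Properties.Semiring.Mult as Mult
import Algebra.Properties.Semiring.Sum as SemiringSum
import Algebra.Solver.CommutativeMonoid as MonoidSolver
open import Data.Fin.Base using (Fin; zero; suc; toℕ)
open import Data.Fin.Properties using (toℕ≤pred[n])
open import Data.Integer.Base as ℤ using (+_)
import Data.Integer.Properties as ℤ
open import Data.Nat.Base as ℕ using (ℕ; zero; suc; _∸_; _!; NonZero)
open import Data.Nat.Combinatorics using (_C_; nCk≡n!/k![n-k]!; k![n∸k]!∣n!)
open import Data.Nat.DivMod using (m/n*n≡m)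
open import Data.Nat.Primality using (Prime)
import Data.Nat.Properties as ℕ
open import Data.Product.Base using (_×_; _,_)
open import Data.Rational.Base as ℚ using (ℚ; _/_)
import Data.Rational.Properties as ℚ
import Data.Rational.Unnormalised.Base as ℚᵘ
import Data.Rational.Unnormalised.Properties as ℚᵘ
open import Function.Base using (_∘_)
open import Relation.Binary.PropositionalEquality as ≡ using (_≡_)
import Relation.Binary.Reasoning.Setoid as SetoidReasoning
open import Algebra.Properties.CommutativeSemigroup ℕ.*-commutativeSemigroup
  using (xy∙z≈xz∙y; xy∙z≈yx∙z; xy∙z≈yz∙x; xy∙z≈zx∙y; xy∙z≈zy∙x)

-- In the sum attached to a permutation (a, b, c) of the weights, each denominator has its own
-- source: the power sum gives 1 + u_{ab}, the Euler polynomial 1 + u_{ac}, the sum over i gives 1 +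
-- u_{bc}. The two geometric sums have lengths c and a, and ab times c equals bc times a, so both
-- numerators are 1 + u_{abc}. Permuting the weights therefore only permutes the denominators. The
-- obstacle is `E` itself: its value depends on a proof that the base lies in the disc, and through
-- it on a recursively computed inverse series. The algebra is therefore done for an arbitrary
-- family of series inverse to q^m e^t + 1, and uniqueness of inverses later identifies this family
-- with the series in the definition of `E`.

nCk*[k!*[n∸k]!]≡n! : ∀ {n k} → k ℕ.≤ n → (n C k) ℕ.* (k ! ℕ.* (n ∸ k) !) ≡ n !
nCk*[k!*[n∸k]!]≡n! {n} {k} k≤n = ≡.trans
  (≡.cong (ℕ._* (k ! ℕ.* (n ∸ k) !)) (nCk≡n!/k![n-k]! k≤n))
  (m/n*n≡m {{k ℕ.!* (n ∸ k) !≢0}} (k![n∸k]!∣n! k≤n))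

-- The operation `/` reduces to lowest terms, so the computation passes to unnormalised rationals,
-- where equality is cross multiplication.
/-*-cancel : ∀ m n .{{_ : NonZero n}} → (+ m / n) ℚ.* (+ n / 1) ≡ + m / 1
/-*-cancel m n@(suc n-1) = ℚ.toℚᵘ-injective (begin
  ℚ.toℚᵘ ((+ m / n) ℚ.* (+ n / 1))              ≈⟨ ℚ.toℚᵘ-homo-* (+ m / n) (+ n / 1) ⟩
  ℚ.toℚᵘ (+ m / n) ℚᵘ.* ℚ.toℚᵘ (+ n / 1)        ≈⟨ ℚᵘ.*-cong (ℚ.toℚᵘ-fromℚᵘ (ℚᵘ.mkℚᵘ (+ m) n-1)) (ℚ.toℚᵘ-fromℚᵘ (ℚᵘ.mkℚᵘ (+ n) 0)) ⟩
  ℚᵘ.mkℚᵘ (+ m) n-1 ℚᵘ.* ℚᵘ.mkℚᵘ (+ n) 0        ≈⟨ ℚᵘ.*≡* cross ⟩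
  ℚᵘ.mkℚᵘ (+ m) 0                               ≈⟨ ℚ.toℚᵘ-fromℚᵘ (ℚᵘ.mkℚᵘ (+ m) 0) ⟨
  ℚ.toℚᵘ (+ m / 1)                              ∎)
  where
  open SetoidReasoning ℚᵘ.≃-setoid
  cross : + m ℤ.* + n ℤ.* + 1 ≡ + m ℤ.* (+ n ℤ.* + 1)
  cross = ℤ.*-assoc (+ m) (+ n) (+ 1)

-- Alternating geometric sums in a commutative ring.

module AlternatingGeometricSum (R : CommutativeRing 0ℓ 0ℓ) where
  open CommutativeRing R
  open SemiringSum semiring using (*-distribˡ-sum; sum-syntax)
  open Exp commutativeSemiring using (_^_; ^-congˡ; ^-assocʳ)
  open RingProperties ring using (-‿distribˡ-*; -‿distribʳ-*; -‿involutive)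
  open SetoidReasoning setoid

  -- Splitting off the term i = 0 leaves a multiple of - x. With the remainder (- x) ^ m kept on the
  -- left, the induction hypothesis appears whole inside that multiple, and 1 + x - x remains.
  [1+x]*∑[-x]^i+[-x]^m≈1 : ∀ x m → (1# + x) * ∑[ i < m ] ((- x) ^ toℕ i) + (- x) ^ m ≈ 1#
  [1+x]*∑[-x]^i+[-x]^m≈1 x zero    = trans (+-congʳ (zeroʳ _)) (+-identityˡ _)
  [1+x]*∑[-x]^i+[-x]^m≈1 x (suc m) = begin
    (1# + x) * (1# + ∑[ i < m ] (z * z ^ toℕ i)) + z * z ^ m  ≈⟨ +-congʳ (*-congˡ (+-congˡ (*-distribˡ-sum z powers))) ⟨
    (1# + x) * (1# + z * s) + z * z ^ m                  ≈⟨ +-congʳ (distribˡ _ _ _) ⟩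
    (1# + x) * 1# + (1# + x) * (z * s) + z * z ^ m       ≈⟨ +-assoc _ _ _ ⟩
    (1# + x) * 1# + ((1# + x) * (z * s) + z * z ^ m)     ≈⟨ +-cong (*-identityʳ _) (+-congʳ (solve 3 (λ a b c → a ⊕ (b ⊕ c) ⊜ b ⊕ (a ⊕ c)) refl _ _ _)) ⟩
    (1# + x) + (z * ((1# + x) * s) + z * z ^ m)          ≈⟨ +-congˡ (distribˡ z _ _) ⟨
    (1# + x) + z * ((1# + x) * s + z ^ m)                ≈⟨ +-congˡ (*-congˡ ([1+x]*∑[-x]^i+[-x]^m≈1 x m)) ⟩
    (1# + x) + z * 1#                                    ≈⟨ +-congˡ (*-identityʳ z) ⟩
    (1# + x) - x                                         ≈⟨ +-assoc _ _ _ ⟩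
    1# + (x - x)                                         ≈⟨ +-congˡ (-‿inverseʳ x) ⟩
    1# + 0#                                              ≈⟨ +-identityʳ 1# ⟩
    1#                                                   ∎
    where
    open MonoidSolver *-commutativeMonoid using (solve; _⊕_; _⊜_)
    z = - x
    powers : Fin m → Carrier
    powers i = z ^ toℕ i
    s = ∑[ i < m ] powers i

  -‿^-odd : ∀ x {m} → Odd m → (- x) ^ m ≈ - (x ^ m)
  -‿^-odd x (k , ≡.refl) = begin
    - x * (- x) ^ (2 ℕ.* k)  ≈⟨ *-congˡ (^-assocʳ (- x) 2 k) ⟨
    - x * ((- x) ^ 2) ^ k    ≈⟨ *-congˡ (^-congˡ k square) ⟩
    - x * (x ^ 2) ^ k        ≈⟨ *-congˡ (^-assocʳ x 2 k) ⟩
    - x * x ^ (2 ℕ.* k)      ≈⟨ -‿distribˡ-* x _ ⟨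
    - (x * x ^ (2 ℕ.* k))    ∎
    where
    square : (- x) ^ 2 ≈ x ^ 2
    square = begin
      - x * (- x * 1#)    ≈⟨ *-congˡ (-‿distribˡ-* x 1#) ⟨
      - x * - (x * 1#)    ≈⟨ -‿distribˡ-* x _ ⟨
      - (x * - (x * 1#))  ≈⟨ -‿cong (-‿distribʳ-* x _) ⟨
      - - (x * (x * 1#))  ≈⟨ -‿involutive _ ⟩
      x * (x * 1#)        ∎

  -- Oddness fixes the sign of the remainder: (- x) ^ m is - (x ^ m), which moves to the right-hand
  -- side as + x ^ m.
  [1+x]*∑[-x]^i≈1+x^m : ∀ x {m} → Odd m → (1# + x) * ∑[ i < m ] ((- x) ^ toℕ i) ≈ 1# + x ^ m
  [1+x]*∑[-x]^i≈1+x^m x {m} m-odd = begin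
    s                          ≈⟨ +-identityʳ s ⟨
    s + 0#                     ≈⟨ +-congˡ (-‿inverseˡ (x ^ m)) ⟨
    s + (- (x ^ m) + x ^ m)    ≈⟨ +-assoc _ _ _ ⟨
    s - x ^ m + x ^ m          ≈⟨ +-congʳ (+-congˡ (-‿^-odd x m-odd)) ⟨
    s + (- x) ^ m + x ^ m      ≈⟨ +-congʳ ([1+x]*∑[-x]^i+[-x]^m≈1 x m) ⟩
    1# + x ^ m                 ∎
    where
    s : Carrier
    s = (1# + x) * ∑[ i < m ] ((- x) ^ toℕ i)

-- The commutative ring of formal power series.

module SeriesRing (R : CommutativeRing 0ℓ 0ℓ) where
  open CommutativeRing R
  open PowerSeries R public
  open SemiringSum semiring using (sum; sum-cong-≋; *-distribˡ-sum; ∑-distrib-+; sum-replicate-zero; sum⁺-syntax)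
  open Exp commutativeSemiring using (_^_; ^-homo-*)
  open MonoidSolver *-commutativeMonoid using (solve; _⊕_; _⊜_)
  open SetoidReasoning setoid

  0ₛ : Series
  0ₛ _ = 0#

  -ₛ_ : Series → Series
  (-ₛ f) n = - f n

  *ₛ-cong : ∀ {f f′ g g′} → f ≈ₛ f′ → g ≈ₛ g′ → f *ₛ g ≈ₛ f′ *ₛ g′
  *ₛ-cong f≈ g≈ n = sum-cong-≋ {suc n} λ i → *-cong (f≈ (toℕ i)) (g≈ (n ∸ toℕ i))

  *ₛ-distribʳ : ∀ h f g → (f +ₛ g) *ₛ h ≈ₛ f *ₛ h +ₛ g *ₛ h
  *ₛ-distribʳ h f g n = trans (sum-cong-≋ {suc n} λ i → distribʳ (h (n ∸ toℕ i)) (f (toℕ i)) (g (toℕ i))) 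
    (∑-distrib-+ {suc n} (λ i → f (toℕ i) * h (n ∸ toℕ i)) (λ i → g (toℕ i) * h (n ∸ toℕ i)))

  ·ₛ-*ₛ-assoc : ∀ c f g → (c ·ₛ f) *ₛ g ≈ₛ c ·ₛ (f *ₛ g)
  ·ₛ-*ₛ-assoc c f g n = trans (sum-cong-≋ {suc n} λ i → *-assoc c (f (toℕ i)) (g (n ∸ toℕ i)))
    (sym (*-distribˡ-sum {suc n} c (λ i → f (toℕ i) * g (n ∸ toℕ i))))

  -- (f *ₛ g) (suc n) unfolds to f 0 * g (suc n) + ((f ∘ suc) *ₛ g) n; the
  -- next lemma is the same recursion on the other factor.
  *ₛ-suc : ∀ f g n → (f *ₛ g) (suc n) ≈ (f *ₛ (g ∘ suc)) n + f (suc n) * g 0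
  *ₛ-suc f g zero    = trans (+-congˡ (+-identityʳ _)) (+-congʳ (sym (+-identityʳ _)))
  *ₛ-suc f g (suc n) = trans (+-congˡ (*ₛ-suc (f ∘ suc) g n)) (sym (+-assoc _ _ _))

  *ₛ-comm : ∀ f g → f *ₛ g ≈ₛ g *ₛ f
  *ₛ-comm f g zero    = +-congʳ (*-comm _ _)
  *ₛ-comm f g (suc n) = begin
    f 0 * g (suc n) + ((f ∘ suc) *ₛ g) n  ≈⟨ +-cong (*-comm _ _) (*ₛ-comm (f ∘ suc) g n) ⟩
    g (suc n) * f 0 + (g *ₛ (f ∘ suc)) n  ≈⟨ +-comm _ _ ⟩
    (g *ₛ (f ∘ suc)) n + g (suc n) * f 0  ≈⟨ *ₛ-suc g f n ⟨
    (g *ₛ f) (suc n)                      ∎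

  -- Induction on the coefficient, for all f at once: the tail of f *ₛ g is definitionally f 0 ·ₛ (g
  -- ∘ suc) +ₛ (f ∘ suc) *ₛ g, so the hypothesis is applied to the tail of f.
  *ₛ-assoc : ∀ f g h → (f *ₛ g) *ₛ h ≈ₛ f *ₛ (g *ₛ h)
  *ₛ-assoc f g h zero    = +-congʳ (begin
    (f 0 * g 0 + 0#) * h 0  ≈⟨ *-congʳ (+-identityʳ _) ⟩
    f 0 * g 0 * h 0         ≈⟨ *-assoc _ _ _ ⟩
    f 0 * (g 0 * h 0)       ≈⟨ *-congˡ (+-identityʳ _) ⟨
    f 0 * (g 0 * h 0 + 0#)  ∎)
  *ₛ-assoc f g h (suc n) = begin
    (f 0 * g 0 + 0#) * h (suc n) + ((f 0 ·ₛ (g ∘ suc) +ₛ (f ∘ suc) *ₛ g) *ₛ h) n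
      ≈⟨ +-cong (trans (*-congʳ (+-identityʳ _)) (*-assoc _ _ _)) (*ₛ-distribʳ h (f 0 ·ₛ (g ∘ suc)) ((f ∘ suc) *ₛ g) n) ⟩
    f 0 * (g 0 * h (suc n)) + (((f 0 ·ₛ (g ∘ suc)) *ₛ h) n + (((f ∘ suc) *ₛ g) *ₛ h) n)
      ≈⟨ +-congˡ (+-cong (·ₛ-*ₛ-assoc (f 0) (g ∘ suc) h n) (*ₛ-assoc (f ∘ suc) g h n)) ⟩
    f 0 * (g 0 * h (suc n)) + (f 0 * ((g ∘ suc) *ₛ h) n + ((f ∘ suc) *ₛ (g *ₛ h)) n)
      ≈⟨ +-assoc _ _ _ ⟨
    f 0 * (g 0 * h (suc n)) + f 0 * ((g ∘ suc) *ₛ h) n + ((f ∘ suc) *ₛ (g *ₛ h)) n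
      ≈⟨ +-congʳ (distribˡ _ _ _) ⟨
    f 0 * (g *ₛ h) (suc n) + ((f ∘ suc) *ₛ (g *ₛ h)) n  ∎

  *ₛ-identityˡ : ∀ f → 1ₛ *ₛ f ≈ₛ f
  *ₛ-identityˡ f zero    = trans (+-identityʳ _) (*-identityˡ _)
  *ₛ-identityˡ f (suc n) = begin
    1# * f (suc n) + ∑[ i ≤ n ] (0# * f (n ∸ toℕ i))  ≈⟨ +-cong (*-identityˡ _) (sum-cong-≋ {suc n} λ i → zeroˡ (f (n ∸ toℕ i))) ⟩
    f (suc n) + ∑[ i ≤ n ] 0#                         ≈⟨ +-congˡ (sum-replicate-zero (suc n)) ⟩
    f (suc n) + 0#                                    ≈⟨ +-identityʳ _ ⟩
    f (suc n)                                         ∎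

  -- With this structure the geometric identity applies to series, and the monoid solver can
  -- rearrange their products.
  seriesRing : CommutativeRing 0ℓ 0ℓ
  seriesRing = record
    { Carrier = Series
    ; _≈_ = _≈ₛ_
    ; _+_ = _+ₛ_
    ; _*_ = _*ₛ_
    ; -_ = -ₛ_
    ; 0# = 0ₛ
    ; 1# = 1ₛ
    ; isCommutativeRing = record
      { isRing = record
        { +-isAbelianGroup = record
          { isGroup = record
            { isMonoid = record
              { isSemigroup = record
                { isMagma = record
                  { isEquivalence = record
                    { refl = λ n → refl
                    ; sym = λ f≈g n → sym (f≈g n)
                    ; trans = λ f≈g g≈h n → trans (f≈g n) (g≈h n)
                    }
                  ; ∙-cong = λ f≈ g≈ n → +-cong (f≈ n) (g≈ n)
                  }
                ; assoc = λ f g h n → +-assoc _ _ _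
                }
              ; identity = (λ f n → +-identityˡ _) , (λ f n → +-identityʳ _)
              }
            ; inverse = (λ f n → -‿inverseˡ _) , (λ f n → -‿inverseʳ _)
            ; ⁻¹-cong = λ f≈g n → -‿cong (f≈g n)
            }
          ; comm = λ f g n → +-comm _ _
          }
        ; *-cong = *ₛ-cong
        ; *-assoc = *ₛ-assoc
        ; *-identity = *ₛ-identityˡ , λ f n → trans (*ₛ-comm f 1ₛ n) (*ₛ-identityˡ f n)
        ; distrib = (λ h f g n → trans (*ₛ-comm h (f +ₛ g) n)
                        (trans (*ₛ-distribʳ h f g n) (+-cong (*ₛ-comm f h n) (*ₛ-comm g h n))))
                  , *ₛ-distribʳ
        }
      ; *-comm = *ₛ-comm
      }
    }

  module 𝕊 where
    open CommutativeRing seriesRing public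
    open Exp (CommutativeRing.commutativeSemiring seriesRing) public
    open SemiringSum (CommutativeRing.semiring seriesRing) public

  sum-coefficient : ∀ {m} (f : Fin m → Series) n → 𝕊.sum f n ≈ sum (λ i → f i n)
  sum-coefficient {zero}  f n = refl
  sum-coefficient {suc m} f n = +-congˡ (sum-coefficient (f ∘ suc) n)

  -- Turns a scalar such as the 2 of the Euler series into a factor that the monoid solver can move.
  ·ₛ≈*ₛ : ∀ c f → c ·ₛ f ≈ₛ (c ·ₛ 1ₛ) *ₛ f
  ·ₛ≈*ₛ c f n = sym (trans (·ₛ-*ₛ-assoc c 1ₛ f n) (*-congˡ (*ₛ-identityˡ f n)))

  -- Both g and h equal f *ₛ g *ₛ h. This frees later arguments from the particular construction of
  -- an inverse series.
  right-inverse-unique : ∀ f g h → f *ₛ g ≈ₛ 1ₛ → f *ₛ h ≈ₛ 1ₛ → g ≈ₛ h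
  right-inverse-unique f g h fg≈1 fh≈1 = 𝕊.trans (𝕊.sym (𝕊.*-identityˡ g))
    (𝕊.trans (𝕊.*-congʳ {g} (𝕊.sym fh≈1))
    (𝕊.trans (solve′ 3 (λ f g h → (f ⊕′ h) ⊕′ g ⊜′ (f ⊕′ g) ⊕′ h) 𝕊.refl f g h)
    (𝕊.trans (𝕊.*-congʳ {h} fg≈1) (𝕊.*-identityˡ h))))
    where open MonoidSolver 𝕊.*-commutativeMonoid using () renaming (solve to solve′; _⊕_ to _⊕′_; _⊜_ to _⊜′_)

  -- The substitution t ↦ c t.
  rescale : Carrier → Series → Series
  rescale c f n = c ^ n * f n

  x^k*x^[n∸k]≈x^n : ∀ x n (k : Fin (suc n)) → x ^ toℕ k * x ^ (n ∸ toℕ k) ≈ x ^ n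
  x^k*x^[n∸k]≈x^n x n k = trans (sym (^-homo-* x (toℕ k) (n ∸ toℕ k)))
    (reflexive (≡.cong (x ^_) (ℕ.m+[n∸m]≡n (toℕ≤pred[n] k))))

  rescale-* : ∀ c f g → rescale c (f *ₛ g) ≈ₛ rescale c f *ₛ rescale c g
  rescale-* c f g n = trans (*-distribˡ-sum {suc n} (c ^ n) (λ i → f (toℕ i) * g (n ∸ toℕ i))) (sum-cong-≋ {suc n} λ i →
    trans (*-congʳ (sym (x^k*x^[n∸k]≈x^n c n i)))
      (solve 4 (λ a b x y → (a ⊕ b) ⊕ (x ⊕ y) ⊜ (a ⊕ x) ⊕ (b ⊕ y)) refl (c ^ toℕ i) (c ^ (n ∸ toℕ i)) (f (toℕ i)) (g (n ∸ toℕ i))))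

  rescale-cong : ∀ c {f g} → f ≈ₛ g → rescale c f ≈ₛ rescale c g
  rescale-cong c f≈g n = *-congˡ (f≈g n)

  rescale-+ : ∀ c f g → rescale c (f +ₛ g) ≈ₛ rescale c f +ₛ rescale c g
  rescale-+ c f g n = distribˡ _ _ _

  rescale-· : ∀ c d f → rescale c (d ·ₛ f) ≈ₛ d ·ₛ rescale c f
  rescale-· c d f n = solve 3 (λ x y z → x ⊕ (y ⊕ z) ⊜ y ⊕ (x ⊕ z)) refl _ _ _

  rescale-1 : ∀ c → rescale c 1ₛ ≈ₛ 1ₛ
  rescale-1 c zero    = *-identityˡ _
  rescale-1 c (suc n) = zeroʳ _

-- Exponential series and exponential generating functions.

module ExponentialSeries (K : ValuedField) (ι : ℚ → ValuedField.Carrier K)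
                         (ι-isHom : IsHom ℚ-ring (ValuedField.commutativeRing K) ι) where
  private
    R = ValuedField.commutativeRing K
  open CommutativeRing R
  open SeriesRing R public
  open SemiringSum semiring using (sum-cong-≋; *-distribˡ-sum; sum-syntax; sum⁺-syntax)
  open Exp commutativeSemiring using (_^_; ^-congˡ; ^-distrib-*; ^-assocʳ)
  open Mult semiring using (×1-homo-*; ×-assoc-*; ×-congʳ) renaming (_×_ to _⋆_)
  open MonoidSolver *-commutativeMonoid using (solve; _⊕_; _⊜_)
  open IsRingHomomorphism ι-isHom using (*-homo; 0#-homo; 1#-homo)
  open SetoidReasoning setoid

  ⌜_⌝ : ℕ → Carrier
  ⌜ n ⌝ = ι (+ n / 1)

  ⌜n⌝≈n×1 : ∀ n → ⌜ n ⌝ ≈ n ⋆ 1#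
  ⌜n⌝≈n×1 zero    = 0#-homo
  ⌜n⌝≈n×1 (suc n) = trans (ι-+ K ι ι-isHom 1 n) (+-cong 1#-homo (⌜n⌝≈n×1 n))

  ⌜⌝-* : ∀ m n → ⌜ m ℕ.* n ⌝ ≈ ⌜ m ⌝ * ⌜ n ⌝
  ⌜⌝-* m n = begin
    ⌜ m ℕ.* n ⌝          ≈⟨ ⌜n⌝≈n×1 (m ℕ.* n) ⟩
    (m ℕ.* n) ⋆ 1#       ≈⟨ ×1-homo-* m n ⟩
    m ⋆ 1# * n ⋆ 1#      ≈⟨ *-cong (⌜n⌝≈n×1 m) (⌜n⌝≈n×1 n) ⟨
    ⌜ m ⌝ * ⌜ n ⌝        ∎

  -- The binomial theorem has repeated addition as its coefficients; here they are matched with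
  -- images of rationals.
  ⌜n⌝*x≈n×x : ∀ n x → ⌜ n ⌝ * x ≈ n ⋆ x
  ⌜n⌝*x≈n×x n x = begin
    ⌜ n ⌝ * x     ≈⟨ *-congʳ (⌜n⌝≈n×1 n) ⟩
    n ⋆ 1# * x    ≈⟨ ×-assoc-* n 1# x ⟩
    n ⋆ (1# * x)  ≈⟨ ×-congʳ n (*-identityˡ x) ⟩
    n ⋆ x         ∎

  ⌜⌝-cancel : ∀ m n .{{_ : NonZero n}} → ι (+ m / n) * ⌜ n ⌝ ≈ ⌜ m ⌝
  ⌜⌝-cancel m n = trans (sym (*-homo (+ m / n) (+ n / 1))) (reflexive (≡.cong ι (/-*-cancel m n)))

  1/_! : ℕ → Carrier
  1/ n ! = ι ((+ 1 / (n !)) {{n ℕ.!≢0}})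

  1/n!*⌜n!⌝≈1 : ∀ n → 1/ n ! * ⌜ n ! ⌝ ≈ 1#
  1/n!*⌜n!⌝≈1 n = trans (⌜⌝-cancel 1 (n !) {{n ℕ.!≢0}}) 1#-homo

  ⌜n!⌝-cancelˡ : ∀ n {x y} → ⌜ n ! ⌝ * x ≈ ⌜ n ! ⌝ * y → x ≈ y
  ⌜n!⌝-cancelˡ n {x} {y} eq = begin
    x                          ≈⟨ *-identityˡ x ⟨
    1# * x                     ≈⟨ *-congʳ (1/n!*⌜n!⌝≈1 n) ⟨
    1/ n ! * ⌜ n ! ⌝ * x       ≈⟨ *-assoc _ _ _ ⟩
    1/ n ! * (⌜ n ! ⌝ * x)     ≈⟨ *-congˡ eq ⟩
    1/ n ! * (⌜ n ! ⌝ * y)     ≈⟨ *-assoc _ _ _ ⟨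
    1/ n ! * ⌜ n ! ⌝ * y       ≈⟨ *-congʳ (1/n!*⌜n!⌝≈1 n) ⟩
    1# * y                     ≈⟨ *-identityˡ y ⟩
    y                          ∎

  -- Since n! = (n C k) k! (n - k)!, multiplying coefficients by factorials turns the Cauchy product
  -- into the binomial sum seen in the theorem.
  binomialConvolution : ∀ f g n → ⌜ n ! ⌝ * (f *ₛ g) n ≈
    ∑[ k ≤ n ] (⌜ n C toℕ k ⌝ * ((⌜ toℕ k ! ⌝ * f (toℕ k)) * (⌜ (n ∸ toℕ k) ! ⌝ * g (n ∸ toℕ k))))
  binomialConvolution f g n = trans (*-distribˡ-sum {suc n} ⌜ n ! ⌝ (λ k → f (toℕ k) * g (n ∸ toℕ k))) (sum-cong-≋ {suc n} term)
    where
    term : (k : Fin (suc n)) → ⌜ n ! ⌝ * (f (toℕ k) * g (n ∸ toℕ k)) ≈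
      ⌜ n C toℕ k ⌝ * ((⌜ toℕ k ! ⌝ * f (toℕ k)) * (⌜ (n ∸ toℕ k) ! ⌝ * g (n ∸ toℕ k)))
    term k = begin
      ⌜ n ! ⌝ * (f j * g l)
        ≡⟨ ≡.cong (λ m → ⌜ m ⌝ * (f j * g l)) (nCk*[k!*[n∸k]!]≡n! (toℕ≤pred[n] k)) ⟨
      ⌜ (n C j) ℕ.* (j ! ℕ.* l !) ⌝ * (f j * g l)
        ≈⟨ *-congʳ (trans (⌜⌝-* (n C j) (j ! ℕ.* l !)) (*-congˡ (⌜⌝-* (j !) (l !)))) ⟩
      ⌜ n C j ⌝ * (⌜ j ! ⌝ * ⌜ l ! ⌝) * (f j * g l)
        ≈⟨ solve 5 (λ a b c x y → (a ⊕ (b ⊕ c)) ⊕ (x ⊕ y) ⊜ a ⊕ ((b ⊕ x) ⊕ (c ⊕ y))) refl _ _ _ _ _ ⟩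
      ⌜ n C j ⌝ * ((⌜ j ! ⌝ * f j) * (⌜ l ! ⌝ * g l)) ∎
      where
      j = toℕ k
      l = n ∸ j

  exp : Carrier → Series
  exp x n = x ^ n * 1/ n !

  ⌜n!⌝*exp : ∀ x n → ⌜ n ! ⌝ * exp x n ≈ x ^ n
  ⌜n!⌝*exp x n = begin
    ⌜ n ! ⌝ * (x ^ n * 1/ n !)  ≈⟨ solve 3 (λ a b c → a ⊕ (b ⊕ c) ⊜ b ⊕ (c ⊕ a)) refl _ _ _ ⟩
    x ^ n * (1/ n ! * ⌜ n ! ⌝)  ≈⟨ *-congˡ (1/n!*⌜n!⌝≈1 n) ⟩
    x ^ n * 1#                  ≈⟨ *-identityʳ _ ⟩
    x ^ n                       ∎

  exp-cong : ∀ {x y} → x ≈ y → exp x ≈ₛ exp y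
  exp-cong x≈y n = *-congʳ (^-congˡ n x≈y)

  exp-0 : exp 0# ≈ₛ 1ₛ
  exp-0 zero    = trans (*-identityˡ _) 1#-homo
  exp-0 (suc n) = trans (*-congʳ (zeroˡ _)) (zeroˡ _)

  -- Multiplied by the invertible n!, the identity of coefficients is the binomial theorem for (x +
  -- y) ^ n.
  exp-+ : ∀ x y → exp x *ₛ exp y ≈ₛ exp (x + y)
  exp-+ x y n = ⌜n!⌝-cancelˡ n (begin
    ⌜ n ! ⌝ * (exp x *ₛ exp y) n    ≈⟨ binomialConvolution (exp x) (exp y) n ⟩
    ∑[ k ≤ n ] (⌜ n C toℕ k ⌝ * ((⌜ toℕ k ! ⌝ * exp x (toℕ k)) * (⌜ (n ∸ toℕ k) ! ⌝ * exp y (n ∸ toℕ k))))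
      ≈⟨ sum-cong-≋ {suc n} (λ k → trans (*-congˡ (*-cong (⌜n!⌝*exp x (toℕ k)) (⌜n!⌝*exp y (n ∸ toℕ k)))) (⌜n⌝*x≈n×x (n C toℕ k) _)) ⟩
    ∑[ k ≤ n ] ((n C toℕ k) ⋆ (x ^ toℕ k * y ^ (n ∸ toℕ k)))  ≈⟨ BinomialTheorem.theorem commutativeSemiring n x y ⟨
    (x + y) ^ n                     ≈⟨ ⌜n!⌝*exp (x + y) n ⟨
    ⌜ n ! ⌝ * exp (x + y) n         ∎)

  rescale-exp : ∀ c x → rescale c (exp x) ≈ₛ exp (c * x)
  rescale-exp c x n = trans (sym (*-assoc _ _ _)) (*-congʳ (sym (^-distrib-* c x n)))

  infix 9 _·exp_

  -- The series c e^(xt). Such series are closed under products and powers, which covers the powers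
  -- of both u_m and - u_m.
  _·exp_ : Carrier → Carrier → Series
  c ·exp x = c ·ₛ exp x

  ·exp-cong : ∀ {c d x y} → c ≈ d → x ≈ y → c ·exp x ≈ₛ d ·exp y
  ·exp-cong c≈d x≈y n = *-cong c≈d (exp-cong x≈y n)

  ·exp-* : ∀ c x d y → c ·exp x *ₛ d ·exp y ≈ₛ (c * d) ·exp (x + y)
  ·exp-* c x d y n = begin
    (c ·exp x *ₛ d ·exp y) n         ≈⟨ ·ₛ-*ₛ-assoc c (exp x) (d ·exp y) n ⟩
    c * (exp x *ₛ d ·exp y) n        ≈⟨ *-congˡ (*ₛ-comm (exp x) (d ·exp y) n) ⟩
    c * (d ·exp y *ₛ exp x) n        ≈⟨ *-congˡ (·ₛ-*ₛ-assoc d (exp y) (exp x) n) ⟩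
    c * (d * (exp y *ₛ exp x) n)     ≈⟨ *-congˡ (*-congˡ (*ₛ-comm (exp y) (exp x) n)) ⟩
    c * (d * (exp x *ₛ exp y) n)     ≈⟨ *-congˡ (*-congˡ (exp-+ x y n)) ⟩
    c * (d * exp (x + y) n)          ≈⟨ *-assoc _ _ _ ⟨
    c * d * exp (x + y) n            ∎

  ·exp-^ : ∀ c x j → c ·exp x 𝕊.^ j ≈ₛ (c ^ j) ·exp (x * ⌜ j ⌝)
  ·exp-^ c x zero    n = begin
    1ₛ n                      ≈⟨ exp-0 n ⟨
    exp 0# n                  ≈⟨ *-identityˡ _ ⟨
    1# * exp 0# n             ≈⟨ *-congˡ (exp-cong (trans (*-congˡ 0#-homo) (zeroʳ x)) n) ⟨
    1# * exp (x * ⌜ 0 ⌝) n    ∎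
  ·exp-^ c x (suc j) n = begin
    (c ·exp x *ₛ (c ·exp x 𝕊.^ j)) n             ≈⟨ 𝕊.*-congˡ {c ·exp x} (·exp-^ c x j) n ⟩
    (c ·exp x *ₛ (c ^ j) ·exp (x * ⌜ j ⌝)) n     ≈⟨ ·exp-* c x (c ^ j) (x * ⌜ j ⌝) n ⟩
    ((c ^ suc j) ·exp (x + x * ⌜ j ⌝)) n         ≈⟨ ·exp-cong refl exponent n ⟩
    ((c ^ suc j) ·exp (x * ⌜ suc j ⌝)) n         ∎
    where
    exponent : x + x * ⌜ j ⌝ ≈ x * ⌜ suc j ⌝
    exponent = begin
      x + x * ⌜ j ⌝         ≈⟨ +-congʳ (*-identityʳ x) ⟨
      x * 1# + x * ⌜ j ⌝    ≈⟨ distribˡ x 1# ⌜ j ⌝ ⟨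
      x * (1# + ⌜ j ⌝)      ≈⟨ *-congˡ (trans (ι-+ K ι ι-isHom 1 j) (+-congʳ 1#-homo)) ⟨
      x * ⌜ suc j ⌝         ∎

-- Generating functions of the six sums.

module EulerSums (K : ValuedField) (ι : ℚ → ValuedField.Carrier K)
                 (ι-isHom : IsHom ℚ-ring (ValuedField.commutativeRing K) ι) where
  open CommutativeRing (ValuedField.commutativeRing K)
  open ExponentialSeries K ι ι-isHom
  open SemiringSum semiring using (sum-cong-≋; *-distribˡ-sum; sum-syntax; sum⁺-syntax)
  open Exp commutativeSemiring using (_^_; ^-congˡ; ^-distrib-*; ^-assocʳ)
  open RingProperties ring using (-1*x≈-x)
  open MonoidSolver *-commutativeMonoid using (solve; _⊕_; _⊜_)
  open AlternatingGeometricSum seriesRing using ([1+x]*∑[-x]^i≈1+x^m)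
  private
    module ≈-Reasoning = SetoidReasoning setoid
    module ≈ₛ-Reasoning = SetoidReasoning 𝕊.setoid

  T : ℕ → Carrier → ℕ → Carrier
  T k r N = ∑[ i ≤ N ] ((- 1#) ^ toℕ i * ⌜ toℕ i ⌝ ^ k * r ^ toℕ i)

  module _ (q : Carrier) (1/[q^_exp+1] : ℕ → Series)
           (*-inverse : ∀ m → (q ^ m ·ₛ exp 1# +ₛ 1ₛ) *ₛ 1/[q^ m exp+1] ≈ₛ 1ₛ) where
    -- (q e^t)^m
    u : ℕ → Series
    u m = (q ^ m) ·exp ⌜ m ⌝

    1/[1+u_] : ℕ → Series
    1/[1+u m ] = rescale ⌜ m ⌝ 1/[q^ m exp+1]

    -- The substitution t ↦ mt is multiplicative and carries q^m e^t + 1 to 1 + u_m, hence carries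
    -- an inverse of the one to an inverse of the other.
    [1+u]*1/[1+u]≈1 : ∀ m → (1ₛ +ₛ u m) *ₛ 1/[1+u m ] ≈ₛ 1ₛ
    [1+u]*1/[1+u]≈1 m = begin
      (1ₛ +ₛ u m) *ₛ 1/[1+u m ]                                      ≈⟨ 𝕊.*-congʳ {1/[1+u m ]} denominator ⟩
      rescale ⌜ m ⌝ (q ^ m ·ₛ exp 1# +ₛ 1ₛ) *ₛ 1/[1+u m ]            ≈⟨ rescale-* ⌜ m ⌝ (q ^ m ·ₛ exp 1# +ₛ 1ₛ) 1/[q^ m exp+1] ⟨
      rescale ⌜ m ⌝ ((q ^ m ·ₛ exp 1# +ₛ 1ₛ) *ₛ 1/[q^ m exp+1])      ≈⟨ rescale-cong ⌜ m ⌝ (*-inverse m) ⟩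
      rescale ⌜ m ⌝ 1ₛ                                               ≈⟨ rescale-1 ⌜ m ⌝ ⟩
      1ₛ                                                             ∎
      where
      open ≈ₛ-Reasoning
      denominator : 1ₛ +ₛ u m ≈ₛ rescale ⌜ m ⌝ (q ^ m ·ₛ exp 1# +ₛ 1ₛ)
      denominator = begin
        1ₛ +ₛ u m                                                   ≈⟨ 𝕊.+-comm 1ₛ (u m) ⟩
        u m +ₛ 1ₛ                                                   ≈⟨ 𝕊.+-cong (·exp-cong refl (*-identityʳ ⌜ m ⌝)) (rescale-1 ⌜ m ⌝) ⟨
        (q ^ m) ·exp (⌜ m ⌝ * 1#) +ₛ rescale ⌜ m ⌝ 1ₛ               ≈⟨ 𝕊.+-congʳ {rescale ⌜ m ⌝ 1ₛ} (λ n → *-congˡ (rescale-exp ⌜ m ⌝ 1# n)) ⟨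
        q ^ m ·ₛ rescale ⌜ m ⌝ (exp 1#) +ₛ rescale ⌜ m ⌝ 1ₛ         ≈⟨ 𝕊.+-congʳ {rescale ⌜ m ⌝ 1ₛ} (rescale-· ⌜ m ⌝ (q ^ m) (exp 1#)) ⟨
        rescale ⌜ m ⌝ (q ^ m ·ₛ exp 1#) +ₛ rescale ⌜ m ⌝ 1ₛ         ≈⟨ rescale-+ ⌜ m ⌝ (q ^ m ·ₛ exp 1#) 1ₛ ⟨
        rescale ⌜ m ⌝ (q ^ m ·ₛ exp 1# +ₛ 1ₛ)                       ∎

    u-^ : ∀ m a → u m 𝕊.^ a ≈ₛ u (m ℕ.* a)
    u-^ m a = 𝕊.trans (·exp-^ (q ^ m) ⌜ m ⌝ a) (·exp-cong (^-assocʳ q m a) (sym (⌜⌝-* m a)))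

    [-u]-^ : ∀ m j → (-ₛ u m) 𝕊.^ j ≈ₛ ((- 1#) ^ j * q ^ (m ℕ.* j)) ·exp (⌜ m ⌝ * ⌜ j ⌝)
    [-u]-^ m j = begin
      (-ₛ u m) 𝕊.^ j                                        ≈⟨ 𝕊.^-congˡ j (λ n → trans (*-assoc _ _ _) (-1*x≈-x _)) ⟨
      (- 1# * q ^ m) ·exp ⌜ m ⌝ 𝕊.^ j                       ≈⟨ ·exp-^ (- 1# * q ^ m) ⌜ m ⌝ j ⟩
      ((- 1# * q ^ m) ^ j) ·exp (⌜ m ⌝ * ⌜ j ⌝)             ≈⟨ ·exp-cong (trans (^-distrib-* (- 1#) (q ^ m) j) (*-congˡ (^-assocʳ q m j))) refl ⟩
      ((- 1#) ^ j * q ^ (m ℕ.* j)) ·exp (⌜ m ⌝ * ⌜ j ⌝)     ∎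
      where open ≈ₛ-Reasoning

    alternating : ℕ → ℕ → Series
    alternating m a = 𝕊.sum {a} (λ i → (-ₛ u m) 𝕊.^ toℕ i)

    alternating≈ : ∀ m {a} → Odd a → alternating m a ≈ₛ 1/[1+u m ] *ₛ (1ₛ +ₛ u (m ℕ.* a))
    alternating≈ m {a} a-odd = begin
      alternating m a                                             ≈⟨ 𝕊.*-identityˡ (alternating m a) ⟨
      1ₛ *ₛ alternating m a                                       ≈⟨ 𝕊.*-congʳ {alternating m a} ([1+u]*1/[1+u]≈1 m) ⟨
      (1ₛ +ₛ u m) *ₛ 1/[1+u m ] *ₛ alternating m a                ≈⟨ 𝕊.*-congʳ {alternating m a} (𝕊.*-comm (1ₛ +ₛ u m) 1/[1+u m ]) ⟩
      1/[1+u m ] *ₛ (1ₛ +ₛ u m) *ₛ alternating m a                ≈⟨ 𝕊.*-assoc 1/[1+u m ] (1ₛ +ₛ u m) (alternating m a) ⟩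
      1/[1+u m ] *ₛ ((1ₛ +ₛ u m) *ₛ alternating m a)              ≈⟨ 𝕊.*-congˡ {1/[1+u m ]} ([1+x]*∑[-x]^i≈1+x^m (u m) a-odd) ⟩
      1/[1+u m ] *ₛ (1ₛ +ₛ u m 𝕊.^ a)                             ≈⟨ 𝕊.*-congˡ {1/[1+u m ]} (𝕊.+-congˡ {1ₛ} (u-^ m a)) ⟩
      1/[1+u m ] *ₛ (1ₛ +ₛ u (m ℕ.* a))                           ∎
      where open ≈ₛ-Reasoning

    powerSum≈alternating : ∀ m {c} → Odd c → ∀ l → ⌜ m ⌝ ^ l * T l (q ^ m) (c ∸ 1) ≈ ⌜ l ! ⌝ * alternating m c l
    -- Matching on oddness exposes c as a successor, so that the range i ≤ c ∸ 1 of `T` is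
    -- definitionally i < c.
    powerSum≈alternating m {c} (_ , ≡.refl) l = begin
      ⌜ m ⌝ ^ l * T l (q ^ m) (c ∸ 1)                              ≈⟨ *-distribˡ-sum {c} (⌜ m ⌝ ^ l) (λ j → (- 1#) ^ toℕ j * ⌜ toℕ j ⌝ ^ l * (q ^ m) ^ toℕ j) ⟩
      ∑[ j < c ] (⌜ m ⌝ ^ l * ((- 1#) ^ toℕ j * ⌜ toℕ j ⌝ ^ l * (q ^ m) ^ toℕ j))  ≈⟨ sum-cong-≋ {c} (λ j → term (toℕ j)) ⟩
      ∑[ j < c ] (⌜ l ! ⌝ * ((-ₛ u m) 𝕊.^ toℕ j) l)                ≈⟨ *-distribˡ-sum {c} ⌜ l ! ⌝ (λ j → ((-ₛ u m) 𝕊.^ toℕ j) l) ⟨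
      ⌜ l ! ⌝ * ∑[ j < c ] (((-ₛ u m) 𝕊.^ toℕ j) l)                ≈⟨ *-congˡ (sum-coefficient {c} (λ j → (-ₛ u m) 𝕊.^ toℕ j) l) ⟨
      ⌜ l ! ⌝ * alternating m c l                                  ∎
      where
      open ≈-Reasoning
      term : ∀ j → ⌜ m ⌝ ^ l * ((- 1#) ^ j * ⌜ j ⌝ ^ l * (q ^ m) ^ j) ≈ ⌜ l ! ⌝ * ((-ₛ u m) 𝕊.^ j) l
      term j = begin
        ⌜ m ⌝ ^ l * ((- 1#) ^ j * ⌜ j ⌝ ^ l * (q ^ m) ^ j)          ≈⟨ solve 4 (λ a b c d → a ⊕ ((b ⊕ c) ⊕ d) ⊜ (b ⊕ d) ⊕ (a ⊕ c)) refl _ _ _ _ ⟩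
        (- 1#) ^ j * (q ^ m) ^ j * (⌜ m ⌝ ^ l * ⌜ j ⌝ ^ l)          ≈⟨ *-cong (*-congˡ (^-assocʳ q m j)) (sym (^-distrib-* ⌜ m ⌝ ⌜ j ⌝ l)) ⟩
        (- 1#) ^ j * q ^ (m ℕ.* j) * (⌜ m ⌝ * ⌜ j ⌝) ^ l            ≈⟨ *-congˡ (⌜n!⌝*exp (⌜ m ⌝ * ⌜ j ⌝) l) ⟨
        (- 1#) ^ j * q ^ (m ℕ.* j) * (⌜ l ! ⌝ * exp (⌜ m ⌝ * ⌜ j ⌝) l)  ≈⟨ solve 3 (λ a b c → a ⊕ (b ⊕ c) ⊜ b ⊕ (a ⊕ c)) refl _ _ _ ⟩
        ⌜ l ! ⌝ * (((- 1#) ^ j * q ^ (m ℕ.* j)) ·exp (⌜ m ⌝ * ⌜ j ⌝)) l  ≈⟨ *-congˡ ([-u]-^ m j l) ⟨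
        ⌜ l ! ⌝ * ((-ₛ u m) 𝕊.^ j) l                                ∎

    prefactor : ℕ → Carrier → Series
    prefactor w z = (⌜ 2 ⌝ ·ₛ 1ₛ) *ₛ exp (⌜ w ⌝ * z) *ₛ ((1ₛ +ₛ u w) *ₛ (1ₛ +ₛ u w))

    -- 2 e^(w z t) (1 + (q e^t)^w)² / ((1 + (q e^t)^l) (1 + (q e^t)^m) (1 + (q e^t)^r))
    symmetricSeries : ℕ → Carrier → ℕ → ℕ → ℕ → Series
    symmetricSeries w z l m r =
      prefactor w z *ₛ (1/[1+u l ] *ₛ 1/[1+u m ] *ₛ 1/[1+u r ])

    symmetricSeries-swapˡ : ∀ w z l m r → symmetricSeries w z l m r ≈ₛ symmetricSeries w z m l r
    symmetricSeries-swapˡ w z l m r = 𝕊.*-congˡ {prefactor w z} (𝕊.*-congʳ {1/[1+u r ]} (𝕊.*-comm 1/[1+u l ] 1/[1+u m ]))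

    symmetricSeries-swapʳ : ∀ w z l m r → symmetricSeries w z l m r ≈ₛ symmetricSeries w z l r m
    symmetricSeries-swapʳ w z l m r = 𝕊.*-congˡ {prefactor w z}
      (solve′ 3 (λ x y z → (x ⊕′ y) ⊕′ z ⊜′ (x ⊕′ z) ⊕′ y) 𝕊.refl 1/[1+u l ] 1/[1+u m ] 1/[1+u r ])
      where open MonoidSolver 𝕊.*-commutativeMonoid using () renaming (solve to solve′; _⊕_ to _⊕′_; _⊜_ to _⊜′_)

    eulerPolynomial : ℕ → ℕ → Carrier → Carrier
    eulerPolynomial k m x = ⌜ k ! ⌝ * ((⌜ 2 ⌝ ·ₛ 1/[q^ m exp+1]) *ₛ exp x) k

    -- The factor m^k is the effect of t ↦ mt on the coefficient of t^k. It replaces q^m e^t by u_m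
    -- and the argument x by mx.
    rescaledEuler : ∀ k m x → ⌜ m ⌝ ^ k * eulerPolynomial k m x ≈ ⌜ k ! ⌝ * ((⌜ 2 ⌝ ·ₛ 1/[1+u m ]) *ₛ exp (⌜ m ⌝ * x)) k
    rescaledEuler k m x = begin
      ⌜ m ⌝ ^ k * (⌜ k ! ⌝ * (f *ₛ exp x) k)                             ≈⟨ solve 3 (λ a b c → a ⊕ (b ⊕ c) ⊜ b ⊕ (a ⊕ c)) refl _ _ _ ⟩
      ⌜ k ! ⌝ * rescale ⌜ m ⌝ (f *ₛ exp x) k                             ≈⟨ *-congˡ (rescale-* ⌜ m ⌝ f (exp x) k) ⟩
      ⌜ k ! ⌝ * (rescale ⌜ m ⌝ f *ₛ rescale ⌜ m ⌝ (exp x)) k             ≈⟨ *-congˡ (*ₛ-cong (rescale-· ⌜ m ⌝ ⌜ 2 ⌝ 1/[q^ m exp+1]) (rescale-exp ⌜ m ⌝ x) k) ⟩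
      ⌜ k ! ⌝ * ((⌜ 2 ⌝ ·ₛ 1/[1+u m ]) *ₛ exp (⌜ m ⌝ * x)) k             ∎
      where
      open ≈-Reasoning
      f : Series
      f = ⌜ 2 ⌝ ·ₛ 1/[q^ m exp+1]

    -- By the hypothesis on x, the index i enters the rescaled exponential only through a factor
    -- e^(lit). With the sign and q^(li) this factor is (- u_l)^i; everything else leaves the sum.
    eulerSum≈alternating : ∀ k m l a z (x : ℕ → Carrier) → (∀ i → ⌜ m ⌝ * x i ≈ z + ⌜ l ⌝ * ⌜ i ⌝) →
      ⌜ m ⌝ ^ k * ∑[ i < a ] ((- 1#) ^ toℕ i * q ^ (l ℕ.* toℕ i) * eulerPolynomial k m (x (toℕ i))) ≈
      ⌜ k ! ⌝ * ((⌜ 2 ⌝ ·ₛ 1/[1+u m ]) *ₛ exp z *ₛ alternating l a) k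
    eulerSum≈alternating k m l a z x mx≈ = begin
      ⌜ m ⌝ ^ k * ∑[ i < a ] (coeff (toℕ i) * eulerPolynomial k m (x (toℕ i)))    ≈⟨ *-distribˡ-sum {a} (⌜ m ⌝ ^ k) (λ i → coeff (toℕ i) * eulerPolynomial k m (x (toℕ i))) ⟩
      ∑[ i < a ] (⌜ m ⌝ ^ k * (coeff (toℕ i) * eulerPolynomial k m (x (toℕ i))))  ≈⟨ sum-cong-≋ {a} (λ i → term (toℕ i)) ⟩
      ∑[ i < a ] (⌜ k ! ⌝ * (f *ₛ exp z *ₛ (-ₛ u l) 𝕊.^ toℕ i) k)   ≈⟨ *-distribˡ-sum {a} ⌜ k ! ⌝ (λ i → (f *ₛ exp z *ₛ (-ₛ u l) 𝕊.^ toℕ i) k) ⟨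
      ⌜ k ! ⌝ * ∑[ i < a ] ((f *ₛ exp z *ₛ (-ₛ u l) 𝕊.^ toℕ i) k)   ≈⟨ *-congˡ (sum-coefficient {a} (λ i → f *ₛ exp z *ₛ (-ₛ u l) 𝕊.^ toℕ i) k) ⟨
      ⌜ k ! ⌝ * 𝕊.sum {a} (λ i → f *ₛ exp z *ₛ (-ₛ u l) 𝕊.^ toℕ i) k  ≈⟨ *-congˡ (𝕊.*-distribˡ-sum {a} (f *ₛ exp z) (λ i → (-ₛ u l) 𝕊.^ toℕ i) k) ⟨
      ⌜ k ! ⌝ * (f *ₛ exp z *ₛ alternating l a) k                   ∎
      where
      open ≈-Reasoning
      f : Series
      f = ⌜ 2 ⌝ ·ₛ 1/[1+u m ]

      coeff : ℕ → Carrier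
      coeff i = (- 1#) ^ i * q ^ (l ℕ.* i)

      term : ∀ i → ⌜ m ⌝ ^ k * (coeff i * eulerPolynomial k m (x i)) ≈ ⌜ k ! ⌝ * (f *ₛ exp z *ₛ (-ₛ u l) 𝕊.^ i) k
      term i = begin
        ⌜ m ⌝ ^ k * (coeff i * eulerPolynomial k m (x i))                     ≈⟨ solve 3 (λ a b c → a ⊕ (b ⊕ c) ⊜ b ⊕ (a ⊕ c)) refl _ _ _ ⟩
        coeff i * (⌜ m ⌝ ^ k * eulerPolynomial k m (x i))                     ≈⟨ *-congˡ (rescaledEuler k m (x i)) ⟩
        coeff i * (⌜ k ! ⌝ * (f *ₛ exp (⌜ m ⌝ * x i)) k)        ≈⟨ *-congˡ (*-congˡ (𝕊.*-congˡ {f} (exp-cong (mx≈ i)) k)) ⟩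
        coeff i * (⌜ k ! ⌝ * (f *ₛ exp (z + y)) k)              ≈⟨ *-congˡ (*-congˡ (𝕊.*-congˡ {f} (exp-+ z y) k)) ⟨
        coeff i * (⌜ k ! ⌝ * (f *ₛ (exp z *ₛ exp y)) k)         ≈⟨ *-congˡ (*-congˡ (*ₛ-assoc f (exp z) (exp y) k)) ⟨
        coeff i * (⌜ k ! ⌝ * (f *ₛ exp z *ₛ exp y) k)           ≈⟨ solve 3 (λ a b c → a ⊕ (b ⊕ c) ⊜ b ⊕ (a ⊕ c)) refl _ _ _ ⟩
        ⌜ k ! ⌝ * (coeff i * (f *ₛ exp z *ₛ exp y) k)           ≈⟨ *-congˡ (*-congˡ (*ₛ-comm (f *ₛ exp z) (exp y) k)) ⟩
        ⌜ k ! ⌝ * (coeff i * (exp y *ₛ (f *ₛ exp z)) k)         ≈⟨ *-congˡ (·ₛ-*ₛ-assoc (coeff i) (exp y) (f *ₛ exp z) k) ⟨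
        ⌜ k ! ⌝ * (coeff i ·exp y *ₛ (f *ₛ exp z)) k            ≈⟨ *-congˡ (*ₛ-comm (coeff i ·exp y) (f *ₛ exp z) k) ⟩
        ⌜ k ! ⌝ * (f *ₛ exp z *ₛ coeff i ·exp y) k              ≈⟨ *-congˡ (𝕊.*-congˡ {f *ₛ exp z} ([-u]-^ l i) k) ⟨
        ⌜ k ! ⌝ * (f *ₛ exp z *ₛ (-ₛ u l) 𝕊.^ i) k              ∎
        where y = ⌜ l ⌝ * ⌜ i ⌝

    summand : (a b c ab bc n : ℕ) → (Fin (suc n) → Fin a → Carrier) → Fin (suc n) → Carrier
    summand a b c ab bc n F k =
      ⌜ n C toℕ k ⌝ * T (n ∸ toℕ k) (q ^ ab) (c ∸ 1) * ⌜ b ⌝ ^ (n ∸ toℕ k) * ⌜ c ⌝ ^ toℕ k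
        * ∑[ i < a ] ((- 1#) ^ toℕ i * q ^ (bc ℕ.* toℕ i) * F k i)

    -- The six sums of the theorem are S a b c for the permutations (a , b , c)
    -- of (w₁ , w₂ , w₃), with F k i the value E_{k,q^(ac)} (b y + (b/a) i);
    -- ab, ac, bc are the pairwise products, in either order.
    S : (a b c ab bc n : ℕ) → (Fin (suc n) → Fin a → Carrier) → Carrier
    S a b c ab bc n F = ⌜ a ⌝ ^ n * ∑[ k ≤ n ] summand a b c ab bc n F k

    -- Characterising F by its values lets the `E` of the theorem be inserted later without
    -- unfolding its inverse series.
    IsEuler : (a b ac n : ℕ) .{{_ : NonZero a}} → Carrier → (Fin (suc n) → Fin a → Carrier) → Set
    IsEuler a b ac n y F = ∀ k i → F k i ≈ eulerPolynomial (toℕ k) ac (⌜ b ⌝ * y + ι (+ b / a) * ⌜ toℕ i ⌝)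

    -- The products come as variables with equations, because the six sums write them in an order
    -- that need not follow (a, b, c). The odd numbers a and c are the lengths of the two
    -- alternating sums.
    S≈symmetricSeries : ∀ a b c ab ac bc w .{{_ : NonZero a}} →
      ab ≡ a ℕ.* b → ac ≡ a ℕ.* c → bc ≡ b ℕ.* c → w ≡ a ℕ.* b ℕ.* c →
      Odd a → Odd c → ∀ n y {F} → IsEuler a b ac n y F →
      S a b c ab bc n F ≈ ⌜ n ! ⌝ * symmetricSeries w y ab ac bc n
    S≈symmetricSeries a b c ab ac bc w ≡.refl ≡.refl ≡.refl ≡.refl a-odd c-odd n y {F} F≈ = begin
      S a b c ab bc n F                                      ≈⟨ *-distribˡ-sum {suc n} (⌜ a ⌝ ^ n) (summand a b c ab bc n F) ⟩
      _                                                      ≈⟨ sum-cong-≋ {suc n} term ⟩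
      _                                                      ≈⟨ binomialConvolution f g n ⟨
      ⌜ n ! ⌝ * (f *ₛ g) n                                   ≈⟨ *-congˡ (f*g≈ n) ⟩
      ⌜ n ! ⌝ * symmetricSeries w y ab ac bc n               ∎
      where
      open ≈-Reasoning
      f g : Series
      f = (⌜ 2 ⌝ ·ₛ 1/[1+u ac ]) *ₛ exp (⌜ w ⌝ * y) *ₛ alternating bc a
      g = alternating ab c

      x : ℕ → Carrier
      x i = ⌜ b ⌝ * y + ι (+ b / a) * ⌜ i ⌝

      -- The factor a of ac cancels the denominator of b/a, so the fractional shift becomes the
      -- integer multiple bc of i.
      ac*x≈ : ∀ i → ⌜ ac ⌝ * x i ≈ ⌜ w ⌝ * y + ⌜ bc ⌝ * ⌜ i ⌝
      ac*x≈ i = begin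
        ⌜ ac ⌝ * (⌜ b ⌝ * y + ι (+ b / a) * ⌜ i ⌝)                               ≈⟨ *-congʳ (⌜⌝-* a c) ⟩
        ⌜ a ⌝ * ⌜ c ⌝ * (⌜ b ⌝ * y + ι (+ b / a) * ⌜ i ⌝)                        ≈⟨ distribˡ _ _ _ ⟩
        ⌜ a ⌝ * ⌜ c ⌝ * (⌜ b ⌝ * y) + ⌜ a ⌝ * ⌜ c ⌝ * (ι (+ b / a) * ⌜ i ⌝)
          ≈⟨ +-cong (solve 4 (λ a b c d → (a ⊕ c) ⊕ (b ⊕ d) ⊜ ((a ⊕ b) ⊕ c) ⊕ d) refl _ _ _ _)
                    (solve 4 (λ a c r d → (a ⊕ c) ⊕ (r ⊕ d) ⊜ ((r ⊕ a) ⊕ c) ⊕ d) refl _ _ _ _) ⟩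
        ⌜ a ⌝ * ⌜ b ⌝ * ⌜ c ⌝ * y + ι (+ b / a) * ⌜ a ⌝ * ⌜ c ⌝ * ⌜ i ⌝
          ≈⟨ +-cong (*-congʳ (trans (⌜⌝-* ab c) (*-congʳ (⌜⌝-* a b))))
                    (*-congʳ (trans (⌜⌝-* b c) (*-congʳ (sym (⌜⌝-cancel b a))))) ⟨
        ⌜ w ⌝ * y + ⌜ bc ⌝ * ⌜ i ⌝                                               ∎

      term : (k : Fin (suc n)) →
        ⌜ a ⌝ ^ n * summand a b c ab bc n F k
        ≈ ⌜ n C toℕ k ⌝ * ((⌜ toℕ k ! ⌝ * f (toℕ k)) * (⌜ (n ∸ toℕ k) ! ⌝ * g (n ∸ toℕ k)))
      term k = begin
        -- Splitting a^n supplies both rescalings: a^j joins c^j to give (ac)^j for the Euler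
        -- polynomial, and a^l joins b^l to give (ab)^l for the power sum.
        ⌜ a ⌝ ^ n * (⌜ n C j ⌝ * t * ⌜ b ⌝ ^ l * ⌜ c ⌝ ^ j * s)                       ≈⟨ *-congʳ (x^k*x^[n∸k]≈x^n ⌜ a ⌝ n k) ⟨
        ⌜ a ⌝ ^ j * ⌜ a ⌝ ^ l * (⌜ n C j ⌝ * t * ⌜ b ⌝ ^ l * ⌜ c ⌝ ^ j * s)
          ≈⟨ solve 7 (λ aj al C t bl cj s → (aj ⊕ al) ⊕ ((((C ⊕ t) ⊕ bl) ⊕ cj) ⊕ s) ⊜ C ⊕ (((aj ⊕ cj) ⊕ s) ⊕ ((al ⊕ bl) ⊕ t))) refl _ _ _ _ _ _ _ ⟩
        ⌜ n C j ⌝ * ((⌜ a ⌝ ^ j * ⌜ c ⌝ ^ j * s) * (⌜ a ⌝ ^ l * ⌜ b ⌝ ^ l * t))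
          ≈⟨ *-congˡ (*-cong (*-congʳ (⌜⌝-*-^ a c j)) (*-congʳ (⌜⌝-*-^ a b l))) ⟨
        ⌜ n C j ⌝ * ((⌜ ac ⌝ ^ j * s) * (⌜ ab ⌝ ^ l * t))
          ≈⟨ *-congˡ (*-congʳ (*-congˡ (sum-cong-≋ {a} (λ i → *-congˡ (F≈ k i))))) ⟩
        ⌜ n C j ⌝ * ((⌜ ac ⌝ ^ j * ∑[ i < a ] (coeff i * eulerPolynomial j ac (x (toℕ i)))) * (⌜ ab ⌝ ^ l * t))
          ≈⟨ *-congˡ (*-cong (eulerSum≈alternating j ac bc a (⌜ w ⌝ * y) x ac*x≈) (powerSum≈alternating ab c-odd l)) ⟩
        ⌜ n C j ⌝ * ((⌜ j ! ⌝ * f j) * (⌜ l ! ⌝ * g l))  ∎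
        where
        j = toℕ k
        l = n ∸ j
        t = T l (q ^ ab) (c ∸ 1)
        coeff : Fin a → Carrier
        coeff i = (- 1#) ^ toℕ i * q ^ (bc ℕ.* toℕ i)
        s = ∑[ i < a ] (coeff i * F k i)
        ⌜⌝-*-^ : ∀ d e i → ⌜ d ℕ.* e ⌝ ^ i ≈ ⌜ d ⌝ ^ i * ⌜ e ⌝ ^ i
        ⌜⌝-*-^ d e i = trans (^-congˡ i (⌜⌝-* d e)) (^-distrib-* ⌜ d ⌝ ⌜ e ⌝ i)

      f*g≈ : f *ₛ g ≈ₛ symmetricSeries w y ab ac bc
      f*g≈ = 𝕊.trans
        (*ₛ-cong (*ₛ-cong (*ₛ-cong {g = exp (⌜ w ⌝ * y)} (·ₛ≈*ₛ ⌜ 2 ⌝ 1/[1+u ac ]) 𝕊.refl) (alternating≈′ bc a-odd bc*a≡w))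
          (alternating≈′ ab c-odd ≡.refl))
        (solve′ 6 (λ d I e J N L → (((d ⊕′ I) ⊕′ e) ⊕′ (J ⊕′ N)) ⊕′ (L ⊕′ N) ⊜′ ((d ⊕′ e) ⊕′ (N ⊕′ N)) ⊕′ ((L ⊕′ I) ⊕′ J))
          𝕊.refl (⌜ 2 ⌝ ·ₛ 1ₛ) 1/[1+u ac ] (exp (⌜ w ⌝ * y)) 1/[1+u bc ] (1ₛ +ₛ u w) 1/[1+u ab ])
        where
        open MonoidSolver 𝕊.*-commutativeMonoid using () renaming (solve to solve′; _⊕_ to _⊕′_; _⊜_ to _⊜′_)
        bc*a≡w : bc ℕ.* a ≡ w
        bc*a≡w = ≡.trans (ℕ.*-comm bc a) (≡.sym (ℕ.*-assoc a b c))
        alternating≈′ : ∀ m {d} → Odd d → m ℕ.* d ≡ w → alternating m d ≈ₛ 1/[1+u m ] *ₛ (1ₛ +ₛ u w)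
        alternating≈′ m {d} d-odd eq = ≡.subst (λ e → alternating m d ≈ₛ 1/[1+u m ] *ₛ (1ₛ +ₛ u e)) eq (alternating≈ m d-odd)

    S-symmetric : ∀ a b c .{{_ : NonZero a}} .{{_ : NonZero b}} .{{_ : NonZero c}} →
      Odd a → Odd b → Odd c → ∀ n y {F₁ F₂ F₃ F₄ F₅ F₆} →
      IsEuler a b (a ℕ.* c) n y F₁ → IsEuler a c (a ℕ.* b) n y F₂ →
      IsEuler b a (b ℕ.* c) n y F₃ → IsEuler b c (a ℕ.* b) n y F₄ →
      IsEuler c a (b ℕ.* c) n y F₅ → IsEuler c b (a ℕ.* c) n y F₆ →
      let S₁ = S a b c (a ℕ.* b) (b ℕ.* c) n F₁
          S₂ = S a c b (a ℕ.* c) (b ℕ.* c) n F₂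
          S₃ = S b a c (a ℕ.* b) (a ℕ.* c) n F₃
          S₄ = S b c a (b ℕ.* c) (a ℕ.* c) n F₄
          S₅ = S c a b (a ℕ.* c) (a ℕ.* b) n F₅
          S₆ = S c b a (b ℕ.* c) (a ℕ.* b) n F₆
      in (S₁ ≈ S₂) × (S₂ ≈ S₃) × (S₃ ≈ S₄) × (S₄ ≈ S₅) × (S₅ ≈ S₆)
    S-symmetric a b c a-odd b-odd c-odd n y {F₁} {F₂} {F₃} {F₄} {F₅} {F₆} F₁≈ F₂≈ F₃≈ F₄≈ F₅≈ F₆≈ =
      -- The indices list the denominators in the order power sum, Euler polynomial, sum over i;
      -- each link is one or two adjacent swaps.
      via S₁≈ S₂≈ (swapˡ ab ac bc) ,
      via S₂≈ S₃≈ (trans (swapˡ ac ab bc) (swapʳ ab ac bc)) ,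
      via S₃≈ S₄≈ (swapˡ ab bc ac) ,
      via S₄≈ S₅≈ (trans (swapʳ bc ab ac) (swapˡ bc ac ab)) ,
      via S₅≈ S₆≈ (swapˡ ac bc ab)
      where
      ab = a ℕ.* b
      ac = a ℕ.* c
      bc = b ℕ.* c
      w = a ℕ.* b ℕ.* c

      Σₙ : ℕ → ℕ → ℕ → Carrier
      Σₙ l m r = ⌜ n ! ⌝ * symmetricSeries w y l m r n

      swapˡ : ∀ l m r → Σₙ l m r ≈ Σₙ m l r
      swapˡ l m r = *-congˡ (symmetricSeries-swapˡ w y l m r n)

      swapʳ : ∀ l m r → Σₙ l m r ≈ Σₙ l r m
      swapʳ l m r = *-congˡ (symmetricSeries-swapʳ w y l m r n)

      via : ∀ {s s′ t t′} → s ≈ t → s′ ≈ t′ → t ≈ t′ → s ≈ s′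
      via s≈t s′≈t′ t≈t′ = trans s≈t (trans t≈t′ (sym s′≈t′))

      S₁≈ : S a b c ab bc n F₁ ≈ Σₙ ab ac bc
      S₁≈ = S≈symmetricSeries a b c ab ac bc w ≡.refl ≡.refl ≡.refl ≡.refl a-odd c-odd n y F₁≈

      S₂≈ : S a c b ac bc n F₂ ≈ Σₙ ac ab bc
      S₂≈ = S≈symmetricSeries a c b ac ab bc w ≡.refl ≡.refl (ℕ.*-comm b c) (xy∙z≈xz∙y a b c) a-odd b-odd n y F₂≈

      S₃≈ : S b a c ab ac n F₃ ≈ Σₙ ab bc ac
      S₃≈ = S≈symmetricSeries b a c ab bc ac w (ℕ.*-comm a b) ≡.refl ≡.refl (xy∙z≈yx∙z a b c) b-odd c-odd n y F₃≈

      S₄≈ : S b c a bc ac n F₄ ≈ Σₙ bc ab ac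
      S₄≈ = S≈symmetricSeries b c a bc ab ac w ≡.refl (ℕ.*-comm a b) (ℕ.*-comm a c) (xy∙z≈yz∙x a b c) b-odd a-odd n y F₄≈

      S₅≈ : S c a b ac ab n F₅ ≈ Σₙ ac bc ab
      S₅≈ = S≈symmetricSeries c a b ac bc ab w (ℕ.*-comm a c) (ℕ.*-comm b c) ≡.refl (xy∙z≈zx∙y a b c) c-odd b-odd n y F₅≈

      S₆≈ : S c b a bc ab n F₆ ≈ Σₙ bc ac ab
      S₆≈ = S≈symmetricSeries c b a bc ac ab w (ℕ.*-comm b c) (ℕ.*-comm a c) (ℕ.*-comm a b) (xy∙z≈zy∙x a b c) c-odd a-odd n y F₆≈

-- Transfer to the Euler polynomials over `ℂₚ`.

module _ {p : ℕ} (p-prime : Prime p) (p-odd : Odd p) (tower : PadicTower p) where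
  open Euler p-prime p-odd tower
  open PowerSeries commutativeRing
  open ValuedFieldProperties ℂₚ using (#0⇒invertible)
  open SeriesRing commutativeRing using (*ₛ-cong; right-inverse-unique)
  open EulerSums ℂₚ ℚ→ℂₚ ℚ→ℂₚ-isHom using (eulerPolynomial; S-symmetric)

  1/denominator : ∀ r → InDisc r → Series
  1/denominator r r∈ = inverse (denominator r) (#0⇒invertible (denominator₀#0 r∈))

  *-1/denominator : ∀ r (r∈ : InDisc r) → denominator r *ₛ 1/denominator r r∈ ≈ₛ 1ₛ
  *-1/denominator r r∈ = *ₛ-inverseʳ (denominator r) (#0⇒invertible (denominator₀#0 r∈))

  denominator-cong : ∀ {r s} → r ≈ s → denominator r ≈ₛ denominator s
  denominator-cong r≈s n = +-congʳ {1ₛ n} (*-congʳ {expₛ 1# n} r≈s)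

  eulerSum : Carrier → (a b c ab bc n : ℕ) .{{_ : NonZero a}} → Carrier → (r : Carrier) → InDisc r → Carrier
  eulerSum q a b c ab bc n y r r∈ =
    ⌜ a ⌝ ^ n * ∑[ k ≤ n ] (⌜ n C toℕ k ⌝ * T (n ∸ toℕ k) (q ^ ab) (c ∸ 1) * ⌜ b ⌝ ^ (n ∸ toℕ k) * ⌜ c ⌝ ^ toℕ k
      * ∑[ i < a ] ((- 1#) ^ toℕ i * q ^ (bc ℕ.* toℕ i)
        * E (toℕ k) r r∈ (⌜ b ⌝ * y + ℚ→ℂₚ (+ b / a) * ⌜ toℕ i ⌝)))

  -- The bases r, s, t stand for q^(ab), q^(ac), q^(bc).
  EulerSumsAgree : Carrier → (a b c n : ℕ) .{{_ : NonZero a}} .{{_ : NonZero b}} .{{_ : NonZero c}} → Carrier →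
    ∀ r → InDisc r → ∀ s → InDisc s → ∀ t → InDisc t → Set
  EulerSumsAgree q a b c n y r r∈ s s∈ t t∈ =
    let S₁ = eulerSum q a b c (a ℕ.* b) (b ℕ.* c) n y s s∈
        S₂ = eulerSum q a c b (a ℕ.* c) (b ℕ.* c) n y r r∈
        S₃ = eulerSum q b a c (a ℕ.* b) (a ℕ.* c) n y t t∈
        S₄ = eulerSum q b c a (b ℕ.* c) (a ℕ.* c) n y r r∈
        S₅ = eulerSum q c a b (a ℕ.* c) (a ℕ.* b) n y t t∈
        S₆ = eulerSum q c b a (b ℕ.* c) (a ℕ.* b) n y s s∈
    in (S₁ ≈ S₂) × (S₂ ≈ S₃) × (S₃ ≈ S₄) × (S₄ ≈ S₅) × (S₅ ≈ S₆)

  module _ (q : Carrier) (1/[q^_exp+1] : ℕ → Series)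
           (*-inverse : ∀ m → denominator (q ^ m) *ₛ 1/[q^ m exp+1] ≈ₛ 1ₛ) where

    -- When r ≈ q ^ m, the series inside `E` and the given one are right inverses of equal
    -- denominators, so they agree whatever disc proof `E` carries.
    E≈eulerPolynomial : ∀ k m x {r} (r∈ : InDisc r) → r ≈ q ^ m → E k r r∈ x ≈ eulerPolynomial q 1/[q^_exp+1] *-inverse k m x
    E≈eulerPolynomial k m x {r} r∈ r≈ = *-congˡ {⌜ k ! ⌝}
      (*ₛ-cong {g = expₛ x} (λ n → *-congˡ {⌜ 2 ⌝} (right-inverse-unique (denominator r) (1/denominator r r∈) 1/[q^ m exp+1]
        (*-1/denominator r r∈) (λ l → trans (*ₛ-cong {g = 1/[q^ m exp+1]} (denominator-cong r≈) (λ j → refl) l) (*-inverse m l)) n))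
        (λ l → refl {expₛ x l}) k)

    eulerSums-agree : ∀ a b c n .{{_ : NonZero a}} .{{_ : NonZero b}} .{{_ : NonZero c}} y →
      Odd a → Odd b → Odd c → ∀ r r∈ s s∈ t t∈ → r ≈ q ^ (a ℕ.* b) → s ≈ q ^ (a ℕ.* c) → t ≈ q ^ (b ℕ.* c) →
      EulerSumsAgree q a b c n y r r∈ s s∈ t t∈
    eulerSums-agree a b c n y a-odd b-odd c-odd r r∈ s s∈ t t∈ r≈ s≈ t≈ =
      S-symmetric q 1/[q^_exp+1] *-inverse a b c a-odd b-odd c-odd n y
        (λ k i → E≈eulerPolynomial (toℕ k) (a ℕ.* c) _ s∈ s≈)
        (λ k i → E≈eulerPolynomial (toℕ k) (a ℕ.* b) _ r∈ r≈)
        (λ k i → E≈eulerPolynomial (toℕ k) (b ℕ.* c) _ t∈ t≈)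
        (λ k i → E≈eulerPolynomial (toℕ k) (a ℕ.* b) _ r∈ r≈)
        (λ k i → E≈eulerPolynomial (toℕ k) (b ℕ.* c) _ t∈ t≈)
        (λ k i → E≈eulerPolynomial (toℕ k) (a ℕ.* c) _ s∈ s≈)

  -- The sums were compared for every r ≈ q ^ m and every proof that r lies in the
  -- disc; a predicate variable P keeps E from being unfolded at InDisc-^ q∈ m.
  at-powers : ∀ {q} (q∈ : InDisc q) l m n (P : ∀ r → InDisc r → ∀ s → InDisc s → ∀ t → InDisc t → Set) →
    (∀ r r∈ s s∈ t t∈ → r ≈ q ^ l → s ≈ q ^ m → t ≈ q ^ n → P r r∈ s s∈ t t∈) →
    P (q ^ l) (InDisc-^ q∈ l) (q ^ m) (InDisc-^ q∈ m) (q ^ n) (InDisc-^ q∈ n)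
  at-powers {q} q∈ l m n P h = h (q ^ l) (InDisc-^ {q} q∈ l) (q ^ m) (InDisc-^ {q} q∈ m) (q ^ n) (InDisc-^ {q} q∈ n) refl refl refl

  theorem4p11 :
    (q : Carrier) (q∈ : InDisc q) →
    (w₁ w₂ w₃ : ℕ) .{{_ : NonZero w₁}} .{{_ : NonZero w₂}} .{{_ : NonZero w₃}} →
    Odd w₁ → Odd w₂ → Odd w₃ →
    (n : ℕ) (y₁ : ℚₚ.Carrier) → IsPadicInteger y₁ →
    let y = ℚₚ→ℂₚ y₁
        S₁ = ⌜ w₁ ⌝ ^ n * ∑[ k ≤ n ] (⌜ n C toℕ k ⌝ * T (n ∸ toℕ k) (q ^ (w₁ ℕ.* w₂)) (w₃ ∸ 1) * ⌜ w₂ ⌝ ^ (n ∸ toℕ k) * ⌜ w₃ ⌝ ^ toℕ k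
            * ∑[ i < w₁ ] ((- 1#) ^ toℕ i * q ^ (w₂ ℕ.* w₃ ℕ.* toℕ i)
              * E (toℕ k) (q ^ (w₁ ℕ.* w₃)) (InDisc-^ q∈ (w₁ ℕ.* w₃)) (⌜ w₂ ⌝ * y + ℚ→ℂₚ (+ w₂ / w₁) * ⌜ toℕ i ⌝)))
        S₂ = ⌜ w₁ ⌝ ^ n * ∑[ k ≤ n ] (⌜ n C toℕ k ⌝ * T (n ∸ toℕ k) (q ^ (w₁ ℕ.* w₃)) (w₂ ∸ 1) * ⌜ w₃ ⌝ ^ (n ∸ toℕ k) * ⌜ w₂ ⌝ ^ toℕ k
            * ∑[ i < w₁ ] ((- 1#) ^ toℕ i * q ^ (w₂ ℕ.* w₃ ℕ.* toℕ i)
              * E (toℕ k) (q ^ (w₁ ℕ.* w₂)) (InDisc-^ q∈ (w₁ ℕ.* w₂)) (⌜ w₃ ⌝ * y + ℚ→ℂₚ (+ w₃ / w₁) * ⌜ toℕ i ⌝)))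
        S₃ = ⌜ w₂ ⌝ ^ n * ∑[ k ≤ n ] (⌜ n C toℕ k ⌝ * T (n ∸ toℕ k) (q ^ (w₁ ℕ.* w₂)) (w₃ ∸ 1) * ⌜ w₁ ⌝ ^ (n ∸ toℕ k) * ⌜ w₃ ⌝ ^ toℕ k
            * ∑[ i < w₂ ] ((- 1#) ^ toℕ i * q ^ (w₁ ℕ.* w₃ ℕ.* toℕ i)
              * E (toℕ k) (q ^ (w₂ ℕ.* w₃)) (InDisc-^ q∈ (w₂ ℕ.* w₃)) (⌜ w₁ ⌝ * y + ℚ→ℂₚ (+ w₁ / w₂) * ⌜ toℕ i ⌝)))
        S₄ = ⌜ w₂ ⌝ ^ n * ∑[ k ≤ n ] (⌜ n C toℕ k ⌝ * T (n ∸ toℕ k) (q ^ (w₂ ℕ.* w₃)) (w₁ ∸ 1) * ⌜ w₃ ⌝ ^ (n ∸ toℕ k) * ⌜ w₁ ⌝ ^ toℕ k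
            * ∑[ i < w₂ ] ((- 1#) ^ toℕ i * q ^ (w₁ ℕ.* w₃ ℕ.* toℕ i)
              * E (toℕ k) (q ^ (w₁ ℕ.* w₂)) (InDisc-^ q∈ (w₁ ℕ.* w₂)) (⌜ w₃ ⌝ * y + ℚ→ℂₚ (+ w₃ / w₂) * ⌜ toℕ i ⌝)))
        S₅ = ⌜ w₃ ⌝ ^ n * ∑[ k ≤ n ] (⌜ n C toℕ k ⌝ * T (n ∸ toℕ k) (q ^ (w₁ ℕ.* w₃)) (w₂ ∸ 1) * ⌜ w₁ ⌝ ^ (n ∸ toℕ k) * ⌜ w₂ ⌝ ^ toℕ k
            * ∑[ i < w₃ ] ((- 1#) ^ toℕ i * q ^ (w₁ ℕ.* w₂ ℕ.* toℕ i)
              * E (toℕ k) (q ^ (w₂ ℕ.* w₃)) (InDisc-^ q∈ (w₂ ℕ.* w₃)) (⌜ w₁ ⌝ * y + ℚ→ℂₚ (+ w₁ / w₃) * ⌜ toℕ i ⌝)))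
        S₆ = ⌜ w₃ ⌝ ^ n * ∑[ k ≤ n ] (⌜ n C toℕ k ⌝ * T (n ∸ toℕ k) (q ^ (w₂ ℕ.* w₃)) (w₁ ∸ 1) * ⌜ w₂ ⌝ ^ (n ∸ toℕ k) * ⌜ w₁ ⌝ ^ toℕ k
            * ∑[ i < w₃ ] ((- 1#) ^ toℕ i * q ^ (w₁ ℕ.* w₂ ℕ.* toℕ i)
              * E (toℕ k) (q ^ (w₁ ℕ.* w₃)) (InDisc-^ q∈ (w₁ ℕ.* w₃)) (⌜ w₂ ⌝ * y + ℚ→ℂₚ (+ w₂ / w₃) * ⌜ toℕ i ⌝)))
    in (S₁ ≈ S₂) × (S₂ ≈ S₃) × (S₃ ≈ S₄) × (S₄ ≈ S₅) × (S₅ ≈ S₆)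
  theorem4p11 q q∈ w₁ w₂ w₃ odd₁ odd₂ odd₃ n y₁ _ =
    at-powers q∈ (w₁ ℕ.* w₂) (w₁ ℕ.* w₃) (w₂ ℕ.* w₃) (EulerSumsAgree q w₁ w₂ w₃ n (ℚₚ→ℂₚ y₁))
      (eulerSums-agree q I *-I w₁ w₂ w₃ n (ℚₚ→ℂₚ y₁) odd₁ odd₂ odd₃)
    where
    I : ℕ → Series
    I m = 1/denominator (q ^ m) (InDisc-^ {q} q∈ m)
    *-I : ∀ m → denominator (q ^ m) *ₛ I m ≈ₛ 1ₛ
    *-I m = *-1/denominator (q ^ m) (InDisc-^ {q} q∈ m)
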